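{- Let $q$ be a prime power, let $b\in\mathbb{F}_q[x]$ be a permutation polynomial of $\mathbb{F}_q$, let $n$ be a positive integer, and let $h, k\in\mathbb{F}_q[x]$ be such that $\gcd\left(h(x),\frac{x^n-1}{x-1}\right)=1$ and $k(\mathbb{F}_q)\subseteq\mathbb{F}_q^*$. Then for every polynomial $f\in\mathbb{F}_{q^n}[x]$ with $T_n[f](x)\equiv b(x)-h(1)\cdot k(x)\cdot x\pmod{x^q-x}$, the polynomial $$\mathcal{P}_{b,f,h,k,n}(x)=f(\mathrm{Tr}_{q^n/q}(x))+k(\mathrm{Tr}_{q^n/q}(x))\cdot L_h(x)$$ is a permutation polynomial of $\mathbb{F}_{q^n}$.
   Context: For $u(x)=\sum_{i=0}^m a_i x^i\in\mathbb{F}_q[x]$, its linearized $q$-associate is $L_u(x)=\sum_{i=0}^m a_i x^{q^i}$. $\mathrm{Tr}_{q^n/q}(x)=x+x^q+\cdots+x^{q^{n-1}}$. For $f(x)=\sum_{i=0}^d a_i x^i\in\mathbb{F}_{q^n}[x]$, $T_n[f](x)=\sum_{i=0}^d\mathrm{Tr}_{q^n/q}(a_i)x^i\in\mathbb{F}_q[x]$. A permutation polynomial of a finite field is a polynomial inducing a bijection of it. -}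

module Defs where

open import Algebra.Apartness.Bundles using (HeytingField)
open import Algebra.Bundles using (CommutativeRing)
open import Algebra.Bundles.Raw using (RawRing)
import Algebra.Definitions.RawSemiring as RawSemiringDefinitions
import Algebra.Morphism.Structures as Morphisms
open import Data.Fin.Base using (Fin; toℕ)
open import Data.List.Base using (List; []; _∷_; foldr; length; lookup; map)
open import Data.Nat.Base as ℕ using (ℕ; zero; suc; _^_; _<_)
open import Data.Nat.Primality using (Prime)
open import Data.Product.Base using (_×_; ∃₂)
open import Function.Bundles using (Inverse)
open import Function.Definitions using (Bijective)
open import Level using (_⊔_)
open import Relation.Binary.PropositionalEquality as ≡ using (_≡_)

IsPrimePower : ℕ → Set
IsPrimePower q = ∃₂ λ p e → Prime p × 0 < e × q ≡ p ^ e

-- In a finite setoid the apartness of a Heyting field is decidable, so it is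
-- the negation of _≈_ and these are exactly the usual fields with q elements.
record FiniteField c ℓ₁ ℓ₂ (q : ℕ) : Set (Level.suc (c ⊔ ℓ₁ ⊔ ℓ₂)) where
  field
    heytingField : HeytingField c ℓ₁ ℓ₂

  open HeytingField heytingField public

  commutativeRing : CommutativeRing c ℓ₁
  commutativeRing = record { isCommutativeRing = isCommutativeRing }

  rawRing : RawRing c ℓ₁
  rawRing = CommutativeRing.rawRing commutativeRing

  field
    enumeration : Inverse setoid (≡.setoid (Fin q))

module Polynomial {c ℓ} (R : RawRing c ℓ) where

  private
    module R = RawRing R

  -- Coefficients listed from the constant term upwards; the leading
  -- coefficient may be zero, so polynomials are compared by _≈_ below.
  Poly : Set c
  Poly = List R.Carrier

  coeff : Poly → ℕ → R.Carrier
  coeff []      _       = R.0#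
  coeff (a ∷ p) zero    = a
  coeff (a ∷ p) (suc i) = coeff p i

  private
    infixl 6 _+ₚ_
    infixl 7 _*ₚ_

    _+ₚ_ : Poly → Poly → Poly
    []      +ₚ r       = r
    (a ∷ p) +ₚ []      = a ∷ p
    (a ∷ p) +ₚ (b ∷ r) = (a R.+ b) ∷ (p +ₚ r)

    _*ₚ_ : Poly → Poly → Poly
    []      *ₚ r = []
    (a ∷ p) *ₚ r = map (a R.*_) r +ₚ (R.0# ∷ p *ₚ r)

  polyRawRing : RawRing c ℓ
  polyRawRing = record
    { Carrier = Poly
    ; _≈_     = λ p r → ∀ i → coeff p i R.≈ coeff r i
    ; _+_     = _+ₚ_
    ; _*_     = _*ₚ_
    ; -_      = map R.-_
    ; 0#      = []
    ; 1#      = R.1# ∷ []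
    }

  open RawRing polyRawRing public
    using (_≈_; _+_; _*_; -_; 0#; 1#)
  open RawSemiringDefinitions (RawRing.rawSemiring polyRawRing) public
    using (sum; _∣_; Coprime) renaming (_^_ to _^ₚ_)

  infixl 6 _-_
  _-_ : Poly → Poly → Poly
  p - r = p + - r

  infix 4 _≡_[mod_]
  _≡_[mod_] : Poly → Poly → Poly → Set (c ⊔ ℓ)
  p ≡ r [mod m ] = m ∣ p - r

  C : R.Carrier → Poly
  C a = a ∷ []

  X : Poly
  X = R.0# ∷ R.1# ∷ []

  eval : Poly → R.Carrier → R.Carrier
  eval p x = foldr (λ a y → a R.+ x R.* y) R.0# p

  infixr 9 _∘ₚ_
  _∘ₚ_ : Poly → Poly → Poly
  p ∘ₚ r = foldr (λ a s → C a + r * s) 0# p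

  IsPermutationPolynomial : Poly → Set (c ⊔ ℓ)
  IsPermutationPolynomial p = Bijective R._≈_ R._≈_ (eval p)

  linearizedAssociate : ℕ → Poly → Poly
  linearizedAssociate q u =
    sum λ (i : Fin (length u)) → C (lookup u i) * X ^ₚ (q ^ toℕ i)

  tracePoly : ℕ → ℕ → Poly
  tracePoly q n = sum λ (i : Fin n) → X ^ₚ (q ^ toℕ i)

  -- The coefficients of T f lie in the subfield with q elements, but T f is
  -- kept as a polynomial over the ring containing the coefficients of f.
  T : ℕ → ℕ → Poly → Poly
  T q n f = map (eval (tracePoly q n)) f

-- The subfield relation is an embedding ι, along which polynomials over the
-- small field are regarded as polynomials over the large one.
module Extension {c ℓ₁ ℓ₂ c′ ℓ₁′ ℓ₂′ q n}
  (F : FiniteField c ℓ₁ ℓ₂ q) (K : FiniteField c′ ℓ₁′ ℓ₂′ (q ^ n)) where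

  module F = FiniteField F
  module K = FiniteField K
  module F[x] = Polynomial F.rawRing
  module K[x] = Polynomial K.rawRing

  open Morphisms.RingMorphisms F.rawRing K.rawRing public
    using (IsRingMonomorphism)

  extend : (F.Carrier → K.Carrier) → F[x].Poly → K[x].Poly
  extend ι = map ι

  𝒫 : (F.Carrier → K.Carrier) → K[x].Poly → F[x].Poly → F[x].Poly → K[x].Poly
  𝒫 ι f h k = f ∘ₚ Tr + (extend ι k ∘ₚ Tr) * extend ι (F[x].linearizedAssociate q h)
    where
    open K[x] using (_+_; _*_; _∘ₚ_)
    Tr = K[x].tracePoly q n

{-# OPTIONS --safe #-}
module Submission where

-- Tr maps the value of P at x to b(Tr x): Tr commutes with L_h, L_h acts on
-- the subfield with q elements as multiplication by h(1), and the term
-- − h(1) k(x) x of T_n[f] cancels the resulting contribution.  So P x = P y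
-- forces Tr x = Tr y, hence L_h(x − y) = 0 and Tr(x − y) = 0.  As Tr is the
-- associate of (x^n − 1)/(x − 1), which is coprime to h, x = y; injectivity
-- suffices on a finite set.

open import Defs
open import Algebra.Bundles using (CommutativeMonoid; CommutativeRing)
open import Algebra.Definitions.RawMagma using (_,_)
open import Algebra.Morphism.Construct.Identity using ()
  renaming (isRingHomomorphism to id-isRingHomomorphism)
import Algebra.Morphism.Structures as Morphisms
import Algebra.Properties.CommutativeMonoid.Sum as Summation
import Algebra.Properties.CommutativeSemigroup as CommutativeSemigroupProperties
import Algebra.Properties.CommutativeSemiring.Binomial as Binomial
import Algebra.Properties.CommutativeSemiring.Exp as Exponentiation
import Algebra.Properties.Monoid.Mult as MonoidMultiplication
import Algebra.Properties.Monoid.Sum as MonoidSum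
import Algebra.Properties.Ring as RingProperties
import Algebra.Properties.Semiring.Mult as Multiplication
import Algebra.Solver.Ring.NaturalCoefficients.Default as RingSolver
open import Data.Empty using (⊥-elim)
open import Data.Fin.Base as Fin using (Fin; zero; suc; toℕ; fromℕ; inject₁; punchIn)
open import Data.Fin.Permutation using (Permutation; permutation)
open import Data.Fin.Properties as Fin
  using (any?; punchInᵢ≢i; <⇒notInjective; toℕ-inject₁; toℕ-fromℕ; toℕ<n)
open import Data.List.Base using ([]; _∷_; _++_; foldr; length; lookup; map; replicate; tabulate)
open import Data.List.Properties
  using (foldr-map; length-++; length-map; length-replicate; length-tabulate)
open import Data.List.Relation.Unary.All as All using (All; []; _∷_)
import Data.List.Relation.Unary.All.Properties as All
open import Data.List.Relation.Unary.AllPairs using (_∷_)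
open import Data.List.Relation.Unary.Unique.Setoid using (Unique)
import Data.List.Relation.Unary.Unique.Setoid.Properties as Unique
open import Data.Nat.Base as ℕ using (ℕ; zero; suc; NonZero; _^_; _<_; s<s; z<s)
open import Data.Nat.Combinatorics using (_C_; nC1≡n; nCn≡1; k>n⇒nCk≡0; nCk+nC[k+1]≡[n+1]C[k+1])
open import Data.Nat.Divisibility as ℕ using (divides; >⇒∤)
open import Data.Nat.Primality using (Prime; euclidsLemma; prime⇒nonZero; prime⇒nonTrivial)
import Data.Nat.Properties as ℕ
open import Data.Nat.Solver using (module +-*-Solver)
open import Data.Product.Base using (_×_; _,_; ∃; proj₁)
open import Data.Sum.Base using (_⊎_; inj₁; inj₂)
open import Function.Base using (_∘_; id)
open import Function.Bundles using (Inverse)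
open import Function.Definitions using (Congruent; Injective; Surjective)
open import Level using (_⊔_)
open import Relation.Binary.Bundles using (Setoid)
open import Relation.Binary.Definitions using (Decidable)
open import Relation.Binary.PropositionalEquality as ≡ using (_≡_; _≢_)
import Relation.Binary.Reasoning.Setoid as SetoidReasoning
open import Relation.Nullary.Decidable as Dec using (Dec; yes; no; decidable-stable)
open import Relation.Nullary.Negation using (contradiction)
open import Relation.Nullary.Negation.Core using (¬_)

-- K is an F[x]-module in which X acts as the Frobenius map x ↦ x^q. Both L_h and Tr are then
-- actions of single polynomials, so their commuting, the factor h(1) on the subfield and the
-- coprimality argument are all facts about one operator `act`. With multiplication by a point in
-- place of Frobenius, the same operator gives polynomial evaluation. Frobenius has to be additive,
-- which rests on the characteristic: translating by 1 permutes K, so q^n · 1 = 0, hence p · 1 = 0.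
-- That Tr x comes from F is a root count: it is fixed by Frobenius, and the q images of F already
-- exhaust the roots of x^q - x. Coprimality only says that common divisors divide 1, so no Bezout
-- identity is at hand; Euclid's algorithm is run so that the common divisor it reaches still
-- annihilates x - y. Existence statements are made constructive by searching the enumeration.

-- Binomial coefficients of prime index

[1+k]*[1+n]C[1+k]≡[1+n]*nCk : ∀ n k → suc k ℕ.* (suc n C suc k) ≡ suc n ℕ.* (n C k)
[1+k]*[1+n]C[1+k]≡[1+n]*nCk zero    zero    = ≡.refl
[1+k]*[1+n]C[1+k]≡[1+n]*nCk zero    (suc k) = ≡.trans
  (≡.cong (suc (suc k) ℕ.*_) (k>n⇒nCk≡0 {suc zero} {suc (suc k)} (s<s z<s)))
  (ℕ.*-zeroʳ (suc (suc k)))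
[1+k]*[1+n]C[1+k]≡[1+n]*nCk (suc n) zero    = ≡.trans (ℕ.*-identityˡ _)
  (≡.trans (nC1≡n (suc (suc n))) (≡.sym (ℕ.*-identityʳ _)))
[1+k]*[1+n]C[1+k]≡[1+n]*nCk (suc n) (suc k) = begin
  suc (suc k) ℕ.* (suc (suc n) C suc (suc k))
    ≡⟨ ≡.cong (suc (suc k) ℕ.*_) (nCk+nC[k+1]≡[n+1]C[k+1] (suc n) (suc k)) ⟨
  suc (suc k) ℕ.* (c ℕ.+ (suc n C suc (suc k)))
    ≡⟨ +-*-Solver.solve 3 (λ k c d → (con 1 :+ k) :* (c :+ d) := c :+ k :* c :+ (con 1 :+ k) :* d)
         ≡.refl (suc k) c (suc n C suc (suc k)) ⟩
  c ℕ.+ suc k ℕ.* c ℕ.+ suc (suc k) ℕ.* (suc n C suc (suc k))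
    ≡⟨ ≡.cong₂ (λ a b → c ℕ.+ a ℕ.+ b) ([1+k]*[1+n]C[1+k]≡[1+n]*nCk n k)
         ([1+k]*[1+n]C[1+k]≡[1+n]*nCk n (suc k)) ⟩
  c ℕ.+ suc n ℕ.* (n C k) ℕ.+ suc n ℕ.* (n C suc k)
    ≡⟨ +-*-Solver.solve 4 (λ c n x y → c :+ n :* x :+ n :* y := c :+ n :* (x :+ y))
         ≡.refl c (suc n) (n C k) (n C suc k) ⟩
  c ℕ.+ suc n ℕ.* ((n C k) ℕ.+ (n C suc k))
    ≡⟨ ≡.cong (λ a → c ℕ.+ suc n ℕ.* a) (nCk+nC[k+1]≡[n+1]C[k+1] n k) ⟩
  suc (suc n) ℕ.* c ∎
  where
  open ≡.≡-Reasoning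
  open +-*-Solver
  c = suc n C suc k

-- By the absorption identity `p` divides k times the coefficient, and it cannot divide k, which is
-- positive and smaller.
prime∣pCk : ∀ {p k} → Prime p → 0 < k → k < p → p ℕ.∣ p C k
prime∣pCk {suc n} {suc k} pp _ k<p with
  euclidsLemma (suc k) (suc n C suc k) pp
    (divides (n C k) (≡.trans ([1+k]*[1+n]C[1+k]≡[1+n]*nCk n k) (ℕ.*-comm (suc n) _)))
... | inj₁ p∣k = contradiction p∣k (>⇒∤ k<p)
... | inj₂ p∣C = p∣C

primePower>1 : ∀ {q} → IsPrimePower q → 1 < q
primePower>1 (p , e , p-prime , 0<e , ≡.refl) = begin
  2      ≤⟨ ℕ.nonTrivial⇒n>1 p {{prime⇒nonTrivial p-prime}} ⟩
  p      ≡⟨ ℕ.^-identityʳ p ⟨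
  p ^ 1  ≤⟨ ℕ.^-monoʳ-≤ p {{prime⇒nonZero p-prime}} 0<e ⟩
  p ^ e  ∎
  where open ℕ.≤-Reasoning

-- Sums and counting over finite setoids

module _ {c ℓ} (M : CommutativeMonoid c ℓ) where
  open CommutativeMonoid M
  open Summation M using (sum; sum-remove; sum-cong-≋; sum-replicate)
  open MonoidMultiplication monoid using () renaming (_×_ to _·_)

  -- The extra `a` fills the one slot where `t` is neutral. In a multiplicative monoid this produces
  -- the power n directly, without passing through n - 1.
  sum-constant-except : ∀ {n} {a : Carrier} (t : Fin n → Carrier) i → t i ≈ ε →
    (∀ j → j ≢ i → t j ≈ a) → a ∙ sum t ≈ n · a
  sum-constant-except {suc n} {a} t i tᵢ≈ε t≈a = ∙-congˡ (begin
    sum t                           ≈⟨ sum-remove {i = i} t ⟩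
    t i ∙ sum (t ∘ punchIn i)       ≈⟨ ∙-congʳ tᵢ≈ε ⟩
    ε ∙ sum (t ∘ punchIn i)         ≈⟨ identityˡ _ ⟩
    sum (t ∘ punchIn i)             ≈⟨ sum-cong-≋ (λ j → t≈a (punchIn i j) (punchInᵢ≢i i j)) ⟩
    sum {n} (λ _ → a)               ≈⟨ sum-replicate n ⟩
    n · a                           ∎)
    where open SetoidReasoning setoid

module FiniteSetoid {c ℓ q} {S : Setoid c ℓ} (enum : Inverse S (≡.setoid (Fin q))) where
  open Setoid S
  open Inverse enum public using (to; from; to-cong)
    renaming (strictlyInverseˡ to to∘from; strictlyInverseʳ to from∘to)

  to-injective : ∀ {x y} → to x ≡ to y → x ≈ y
  to-injective {x} {y} eq =
    trans (sym (from∘to x)) (trans (reflexive (≡.cong from eq)) (from∘to y))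

  from-injective : ∀ {i j} → from i ≈ from j → i ≡ j
  from-injective {i} {j} eq = ≡.trans (≡.sym (to∘from i)) (≡.trans (to-cong eq) (to∘from j))

  infix 4 _≟_
  _≟_ : Decidable _≈_
  x ≟ y = Dec.map′ to-injective to-cong (to x Fin.≟ to y)

  -- Exhaustive search over the enumeration. Its decidability is what later turns double-negated
  -- existence into witnesses.
  preimage? : ∀ {c′ ℓ′} (T : Setoid c′ ℓ′) → Decidable (Setoid._≈_ T) →
    (f : Carrier → Setoid.Carrier T) → Congruent _≈_ (Setoid._≈_ T) f →
    ∀ y → Dec (∃ λ x → Setoid._≈_ T (f x) y)
  preimage? T _≟′_ f f-cong y = Dec.map′
    (λ (i , eq) → from i , eq)
    (λ (x , eq) → to x , Setoid.trans T (f-cong (from∘to x)) eq)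
    (any? (λ i → f (from i) ≟′ y))

  -- Pigeonhole: if `y` were missed, `y` together with the q values of `f` would embed `Fin (suc q)`
  -- into `Fin q`.
  injective⇒surjective : {f : Carrier → Carrier} → Congruent _≈_ _≈_ f →
    Injective _≈_ _≈_ f → Surjective _≈_ _≈_ f
  injective⇒surjective {f} f-cong f-inj y with preimage? S _≟_ f f-cong y
  ... | yes (x , fx≈y) = x , λ z≈x → trans (f-cong z≈x) fx≈y
  ... | no ∄x = ⊥-elim (<⇒notInjective {f = g} (ℕ.n<1+n q) g-injective)
    where
    g : Fin (suc q) → Fin q
    g zero    = to y
    g (suc i) = to (f (from i))

    g-injective : Injective _≡_ _≡_ g
    g-injective {zero}  {zero}  eq = ≡.refl
    g-injective {zero}  {suc j} eq = contradiction (from j , sym (to-injective eq)) ∄x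
    g-injective {suc i} {zero}  eq = contradiction (from i , to-injective eq) ∄x
    g-injective {suc i} {suc j} eq = ≡.cong suc (from-injective (f-inj (to-injective eq)))

  module _ {c′ ℓ′} (M : CommutativeMonoid c′ ℓ′) where
    private module M = CommutativeMonoid M
    open Summation M using (sum; sum-permute; sum-cong-≋)

    -- Conjugation by the enumeration makes a permutation of indices out of `σ`. It is used for
    -- translation by 1 in the additive monoid and for scaling by a unit in the multiplicative one.
    sum-reindex : (g : Carrier → M.Carrier) → Congruent _≈_ M._≈_ g → (σ σ⁻¹ : Carrier → Carrier) →
      Congruent _≈_ _≈_ σ → Congruent _≈_ _≈_ σ⁻¹ → (∀ x → σ (σ⁻¹ x) ≈ x) → (∀ x → σ⁻¹ (σ x) ≈ x) →
      sum (g ∘ from) M.≈ sum (g ∘ σ ∘ from)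
    sum-reindex g g-cong σ σ⁻¹ σ-cong σ⁻¹-cong σσ⁻¹ σ⁻¹σ = M.trans
      (sum-permute (g ∘ from) π)
      (sum-cong-≋ (λ i → g-cong (from∘to (σ (from i)))))
      where
      π : Permutation q q
      π = permutation (to ∘ σ ∘ from) (to ∘ σ⁻¹ ∘ from)
        (λ i → ≡.trans (to-cong (trans (σ-cong (from∘to _)) (σσ⁻¹ _))) (to∘from i))
        (λ i → ≡.trans (to-cong (trans (σ⁻¹-cong (from∘to _)) (σ⁻¹σ _))) (to∘from i))

-- Finite fields: inverses, Fermat's identity, characteristic and Frobenius

module FiniteFieldProperties {c ℓ₁ ℓ₂ q} (F : FiniteField c ℓ₁ ℓ₂ q) where
  open FiniteField F using (#⇒invertible; tight; enumeration; commutativeRing)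
  open CommutativeRing commutativeRing hiding (zero)
  open FiniteSetoid {S = setoid} enumeration public
  open RingProperties ring public
  open Exponentiation commutativeSemiring public renaming (_^_ to _^′_)
  open Multiplication semiring renaming (_×_ to _·_) public
  open SetoidReasoning setoid

  -- The field axioms invert differences of apart elements only. Without an inverse, `x` could not
  -- be apart from 0, so tightness would give `x ≈ 0#`; the double negation is removed because the
  -- search for an inverse is decidable.
  nonzero⇒invertible : ∀ {x} → ¬ (x ≈ 0#) → ∃ λ x⁻¹ → x * x⁻¹ ≈ 1#
  nonzero⇒invertible {x} x≉0 = decidable-stable
    (preimage? setoid _≟_ (x *_) *-congˡ 1#)
    λ ∄ → x≉0 (proj₁ (tight x 0#) λ x#0 →
      let y , _ , eq = #⇒invertible x#0 in
      ∄ (y , trans (*-congʳ (sym (trans (+-congˡ -0#≈0#) (+-identityʳ x)))) eq))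

  *-cancelˡ-nonzero : ∀ {x y z} → ¬ (x ≈ 0#) → x * y ≈ x * z → y ≈ z
  *-cancelˡ-nonzero {x} {y} {z} x≉0 eq with nonzero⇒invertible x≉0
  ... | x⁻¹ , inv = begin
    y              ≈⟨ *-identityˡ y ⟨
    1# * y         ≈⟨ *-congʳ (trans (*-comm x⁻¹ x) inv) ⟨
    x⁻¹ * x * y    ≈⟨ *-assoc x⁻¹ x y ⟩
    x⁻¹ * (x * y)  ≈⟨ *-congˡ eq ⟩
    x⁻¹ * (x * z)  ≈⟨ *-assoc x⁻¹ x z ⟨
    x⁻¹ * x * z    ≈⟨ *-congʳ (trans (*-comm x⁻¹ x) inv) ⟩
    1# * z         ≈⟨ *-identityˡ z ⟩
    z              ∎

  integral : ∀ x y → x * y ≈ 0# → x ≈ 0# ⊎ y ≈ 0#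
  integral x y eq with x ≟ 0#
  ... | yes x≈0 = inj₁ x≈0
  ... | no  x≉0 = inj₂ (*-cancelˡ-nonzero x≉0 (trans eq (sym (zeroʳ x))))

  ^-zero⇒zero : ∀ x n → x ^′ n ≈ 0# → x ≈ 0#
  ^-zero⇒zero x zero    1≈0 = trans (sym (*-identityʳ x)) (trans (*-congˡ 1≈0) (zeroʳ x))
  ^-zero⇒zero x (suc n) eq with integral x _ eq
  ... | inj₁ x≈0 = x≈0
  ... | inj₂ eq′ = ^-zero⇒zero x n eq′

  -- Translation by 1 permutes the field, so the sum of all elements equals itself plus q · 1.
  card·1≈0 : q · 1# ≈ 0#
  card·1≈0 = begin
    q · 1#                             ≈⟨ sum-replicate q ⟨
    ones                               ≈⟨ +-identityˡ _ ⟨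
    0# + ones                          ≈⟨ +-congʳ (-‿inverseˡ _) ⟨
    - sum from + sum from + ones       ≈⟨ +-assoc _ _ _ ⟩
    - sum from + (sum from + ones)     ≈⟨ +-congˡ (∑-distrib-+ from (λ _ → 1#)) ⟨
    - sum from + sum (λ i → from i + 1#)
      ≈⟨ +-congˡ (sum-reindex +-commutativeMonoid id id (_+ 1#) (_- 1#)
                                            +-congʳ +-congʳ (//-rightDividesˡ 1#) (//-rightDividesʳ 1#)) ⟨
    - sum from + sum from              ≈⟨ -‿inverseˡ _ ⟩
    0#                                 ∎
    where
    open Summation +-commutativeMonoid
    ones = sum {q} (λ _ → 1#)

  private
    open Summation *-commutativeMonoid
      using () renaming (sum to prod; ∑-distrib-+ to ∏-distrib-*; sum-cong-≋ to prod-cong)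

    -- Zero is replaced by 1, so that products run over the whole enumeration and stay invertible;
    -- the multiplicative group never has to be enumerated separately.
    selectUnit : ∀ {x} → Dec (x ≈ 0#) → Carrier → Carrier
    selectUnit (yes _) y = 1#
    selectUnit (no  _) y = y

    unit : Carrier → Carrier
    unit x = selectUnit (x ≟ 0#) x

    unit-cong : Congruent _≈_ _≈_ unit
    unit-cong {x} {y} x≈y with x ≟ 0# | y ≟ 0#
    ... | yes _   | yes _   = refl
    ... | no  _   | no  _   = x≈y
    ... | yes x≈0 | no  y≉0 = contradiction (trans (sym x≈y) x≈0) y≉0
    ... | no  x≉0 | yes y≈0 = contradiction (trans x≈y y≈0) x≉0

    prod-invertible : ∀ {n} (t : Fin n → Carrier) → (∀ i → ∃ λ y → t i * y ≈ 1#) →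
      ∃ λ y → prod t * y ≈ 1#
    prod-invertible {zero}  t inv = 1# , *-identityˡ 1#
    prod-invertible {suc n} t inv with inv zero | prod-invertible (t ∘ suc) (inv ∘ suc)
    ... | y , eq | z , eq′ = y * z , (begin
      t zero * prod (t ∘ suc) * (y * z)   ≈⟨ interchange _ _ _ _ ⟩
      (t zero * y) * (prod (t ∘ suc) * z) ≈⟨ *-cong eq eq′ ⟩
      1# * 1#                             ≈⟨ *-identityˡ 1# ⟩
      1#                                  ∎)
      where open CommutativeSemigroupProperties *-commutativeSemigroup using (interchange)

    unit-invertible : ∀ x → ∃ λ y → unit x * y ≈ 1#
    unit-invertible x with x ≟ 0#
    ... | yes _   = 1# , *-identityˡ 1#
    ... | no  x≉0 = nonzero⇒invertible x≉0

    module _ {a} (a≉0 : ¬ (a ≈ 0#)) where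
      scale : Carrier → Carrier
      scale x = selectUnit (x ≟ 0#) a

      scale-zero : ∀ {x} → x ≈ 0# → scale x ≈ 1#
      scale-zero {x} x≈0 with x ≟ 0#
      ... | yes _   = refl
      ... | no  x≉0 = contradiction x≈0 x≉0

      scale-nonzero : ∀ {x} → ¬ (x ≈ 0#) → scale x ≈ a
      scale-nonzero {x} x≉0 with x ≟ 0#
      ... | yes x≈0 = contradiction x≈0 x≉0
      ... | no  _   = refl

      unit-* : ∀ x → unit (a * x) ≈ scale x * unit x
      unit-* x with x ≟ 0# | (a * x) ≟ 0#
      ... | yes _   | yes _    = sym (*-identityˡ 1#)
      ... | yes x≈0 | no ax≉0  = contradiction (trans (*-congˡ x≈0) (zeroʳ a)) ax≉0
      ... | no x≉0  | yes ax≈0 = contradiction (*-cancelˡ-nonzero a≉0 (trans ax≈0 (sym (zeroʳ a)))) x≉0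
      ... | no _    | no _     = refl

      -- Scaling by a permutes the field, so the product `U` of all units satisfies U = S · U, and
      -- the invertible `U` cancels.
      prod-scale≈1 : prod (scale ∘ from) ≈ 1#
      prod-scale≈1 with prod-invertible (unit ∘ from) (unit-invertible ∘ from) | nonzero⇒invertible a≉0
      ... | y , eq | a⁻¹ , inv = begin
        S              ≈⟨ *-identityʳ S ⟨
        S * 1#         ≈⟨ *-congˡ eq ⟨
        S * (U * y)    ≈⟨ *-assoc S U y ⟨
        S * U * y      ≈⟨ *-congʳ (∏-distrib-* (scale ∘ from) (unit ∘ from)) ⟨
        prod (λ i → scale (from i) * unit (from i)) * y
                       ≈⟨ *-congʳ (prod-cong (λ i → unit-* (from i))) ⟨
        prod (λ i → unit (a * from i)) * y
                       ≈⟨ *-congʳ (sum-reindex *-commutativeMonoid unit unit-cong (a *_) (a⁻¹ *_)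
                            *-congˡ *-congˡ (cancel inv) (cancel (trans (*-comm _ _) inv))) ⟨
        U * y          ≈⟨ eq ⟩
        1#             ∎
        where
        S = prod (scale ∘ from)
        U = prod (unit ∘ from)
        cancel : ∀ {b b′} → b * b′ ≈ 1# → ∀ x → b * (b′ * x) ≈ x
        cancel bb′≈1 x = trans (sym (*-assoc _ _ x)) (trans (*-congʳ bb′≈1) (*-identityˡ x))

  card-nonZero : NonZero q
  card-nonZero = Fin.nonZeroIndex (to 0#)

  zero-^-card : 0# ^′ q ≈ 0#
  zero-^-card = go q {{card-nonZero}}
    where
    go : ∀ n .{{_ : NonZero n}} → 0# ^′ n ≈ 0#
    go (suc n) = zeroˡ _

  x^card≈x : ∀ x → x ^′ q ≈ x
  x^card≈x x with x ≟ 0#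
  ... | yes x≈0 = trans (^-congˡ q x≈0) (trans zero-^-card (sym x≈0))
  ... | no  x≉0 = begin
    x ^′ q
      -- The product of scale factors contains x at every nonzero element and 1 at zero; one further
      -- x completes the q-th power.
      ≈⟨ sum-constant-except *-commutativeMonoid (scale x≉0 ∘ from) (to 0#)
                                         (scale-zero x≉0 (from∘to 0#))
                                         (λ j j≢ → scale-nonzero x≉0 λ eq → j≢ (≡.trans (≡.sym (to∘from j)) (to-cong eq))) ⟨
    x * prod (scale x≉0 ∘ from)     ≈⟨ *-congˡ (prod-scale≈1 x≉0) ⟩
    x * 1#                          ≈⟨ *-identityʳ x ⟩
    x                               ∎

  -- If 1 were 0, all elements would coincide and the constant map into `Fin 1` would be injective.
  nontrivial : 1 < q → ¬ (1# ≈ 0#)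
  nontrivial 1<q 1≈0 = <⇒notInjective {f = λ _ → Fin.zero {0}} 1<q λ {i} {j} _ → from-injective {i} {j} (begin
    from i       ≈⟨ *-identityˡ _ ⟨
    1# * from i  ≈⟨ *-congʳ 1≈0 ⟩
    0# * from i  ≈⟨ trans (zeroˡ _) (sym (zeroˡ _)) ⟩
    0# * from j  ≈⟨ *-congʳ 1≈0 ⟨
    1# * from j  ≈⟨ *-identityˡ _ ⟩
    from j       ∎)

  module Characteristic {p} (p-prime : Prime p) (m : ℕ) (q≡p^m : q ≡ p ^ m) where
    -- The m-th power of `p · 1#` is `q · 1#`, which is zero, and a field has no nonzero nilpotents.
    char·1≈0 : p · 1# ≈ 0#
    char·1≈0 = ^-zero⇒zero (p · 1#) m (trans (sym (power m)) (trans (sym (×-congˡ q≡p^m)) card·1≈0))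
      where
      power : ∀ m → (p ^ m) · 1# ≈ (p · 1#) ^′ m
      power zero    = +-identityʳ 1#
      power (suc m) = trans (×1-homo-* p (p ^ m)) (*-congˡ (power m))

    char∣⇒·≈0 : ∀ {k} → p ℕ.∣ k → ∀ x → k · x ≈ 0#
    char∣⇒·≈0 (divides j ≡.refl) x = begin
      (j ℕ.* p) · x         ≈⟨ ×-congʳ (j ℕ.* p) (*-identityˡ x) ⟨
      (j ℕ.* p) · (1# * x)  ≈⟨ ×-assoc-* (j ℕ.* p) 1# x ⟨
      ((j ℕ.* p) · 1#) * x  ≈⟨ *-congʳ (×1-homo-* j p) ⟩
      (j · 1#) * (p · 1#) * x ≈⟨ *-congʳ (trans (*-congˡ char·1≈0) (zeroʳ _)) ⟩
      0# * x                ≈⟨ zeroˡ x ⟩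
      0#                    ∎

    -- In the binomial expansion every interior coefficient is a multiple of `p`; only the two end
    -- terms survive, first y^p and then x^p.
    ^-char-+ : ∀ x y → (x + y) ^′ p ≈ x ^′ p + y ^′ p
    ^-char-+ x y = go p ≡.refl
      where
      open Summation +-commutativeMonoid
      -- The copy `r` can be split as a successor while the equation keeps primality available.
      go : ∀ r → p ≡ r → (x + y) ^′ r ≈ x ^′ r + y ^′ r
      go zero    eq = contradiction eq (ℕ.≢-nonZero⁻¹ p {{prime⇒nonZero p-prime}})
      go (suc r) eq = begin
        (x + y) ^′ suc r                 ≈⟨ Binomial.theorem commutativeSemiring (suc r) x y ⟩
        term zero + sum (term ∘ suc)     ≈⟨ +-congˡ (sum-init-last (term ∘ suc)) ⟩
        term zero + (sum (term ∘ suc ∘ inject₁) + term (suc (fromℕ r)))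
          ≈⟨ +-congˡ (+-cong (trans (sum-cong-≋ middle) (sum-replicate-zero r))
               (last-term (≡.cong suc (toℕ-fromℕ r)))) ⟩
        term zero + (0# + x ^′ suc r)
          ≈⟨ +-cong (trans (×-homo-1 _) (*-identityˡ _)) (+-identityˡ _) ⟩
        y ^′ suc r + x ^′ suc r          ≈⟨ +-comm _ _ ⟩
        x ^′ suc r + y ^′ suc r          ∎
        where
        term = Binomial.binomialTerm commutativeSemiring x y (suc r)

        middle : ∀ i → term (suc (inject₁ i)) ≈ 0#
        middle i = char∣⇒·≈0 (≡.subst (λ s → s ℕ.∣ suc r C suc (toℕ (inject₁ i))) (≡.sym eq)
          (prime∣pCk (≡.subst Prime eq p-prime) z<s
            (s<s (≡.subst (_< r) (≡.sym (toℕ-inject₁ i)) (toℕ<n i))))) _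

        last-term : ∀ {k} → k ≡ suc r → (suc r C k) · (x ^′ k * y ^′ (suc r ℕ.∸ k)) ≈ x ^′ suc r
        last-term ≡.refl = begin
          (suc r C suc r) · (x ^′ suc r * y ^′ (r ℕ.∸ r)) ≈⟨ ×-congˡ (nCn≡1 (suc r)) ⟩
          1 · (x ^′ suc r * y ^′ (r ℕ.∸ r))               ≈⟨ ×-homo-1 _ ⟩
          x ^′ suc r * y ^′ (r ℕ.∸ r)                     ≈⟨ *-congˡ (^-congʳ y (ℕ.n∸n≡0 r)) ⟩
          x ^′ suc r * 1#                                 ≈⟨ *-identityʳ _ ⟩
          x ^′ suc r                                      ∎

    ^-char^-+ : ∀ e x y → (x + y) ^′ (p ^ e) ≈ x ^′ (p ^ e) + y ^′ (p ^ e)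
    ^-char^-+ zero    x y = trans (*-identityʳ _) (+-cong (sym (*-identityʳ x)) (sym (*-identityʳ y)))
    ^-char^-+ (suc e) x y = begin
      (x + y) ^′ (p ℕ.* p ^ e)                     ≈⟨ ^-assocʳ (x + y) p (p ^ e) ⟨
      ((x + y) ^′ p) ^′ (p ^ e)                    ≈⟨ ^-congˡ (p ^ e) (^-char-+ x y) ⟩
      (x ^′ p + y ^′ p) ^′ (p ^ e)                 ≈⟨ ^-char^-+ e (x ^′ p) (y ^′ p) ⟩
      (x ^′ p) ^′ (p ^ e) + (y ^′ p) ^′ (p ^ e)
        ≈⟨ +-cong (^-assocʳ x p (p ^ e)) (^-assocʳ y p (p ^ e)) ⟩
      x ^′ (p ℕ.* p ^ e) + y ^′ (p ℕ.* p ^ e)      ∎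

  -- Here `r` is the size of a smaller field and `q` that of the present one. Both are powers of the
  -- same prime, so raising to `r` iterates the p-th power map.
  ^-primePower-+ : ∀ {r} → IsPrimePower r → ∀ m → q ≡ r ^ m → ∀ x y → (x + y) ^′ r ≈ x ^′ r + y ^′ r
  ^-primePower-+ (p , e , p-prime , _ , ≡.refl) m q≡r^m =
    Characteristic.^-char^-+ p-prime (e ℕ.* m) (≡.trans q≡r^m (ℕ.^-*-assoc p e m)) e

-- Coefficientwise arithmetic and divisibility of polynomials

module PolynomialProperties {c ℓ} (R : CommutativeRing c ℓ) where
  private module R = CommutativeRing R
  open R using (_≈_; 0#; 1#; refl; sym; trans)
  open Polynomial R.rawRing public using (coeff; X)
  private module P = Polynomial R.rawRing
  open RingProperties R.ring
  open CommutativeSemigroupProperties R.+-commutativeSemigroup using (interchange; x∙yz≈y∙xz)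
  open SetoidReasoning R.setoid

  coeff-+ : ∀ p r i → coeff (p P.+ r) i ≈ coeff p i R.+ coeff r i
  coeff-+ []      r       i       = sym (R.+-identityˡ _)
  coeff-+ (a ∷ p) []      i       = sym (R.+-identityʳ _)
  coeff-+ (a ∷ p) (b ∷ r) zero    = refl
  coeff-+ (a ∷ p) (b ∷ r) (suc i) = coeff-+ p r i

  coeff-scale : ∀ a p i → coeff (map (a R.*_) p) i ≈ a R.* coeff p i
  coeff-scale a []      i       = sym (R.zeroʳ a)
  coeff-scale a (b ∷ p) zero    = refl
  coeff-scale a (b ∷ p) (suc i) = coeff-scale a p i

  coeff-neg : ∀ p i → coeff (P.- p) i ≈ R.- coeff p i
  coeff-neg []      i       = sym -0#≈0#
  coeff-neg (a ∷ p) zero    = refl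
  coeff-neg (a ∷ p) (suc i) = coeff-neg p i

  shift-cong : ∀ {p r} → p P.≈ r → (0# ∷ p) P.≈ (0# ∷ r)
  shift-cong p≈r zero    = refl
  shift-cong p≈r (suc i) = p≈r i

  coeff-∷-* : ∀ a p r i → coeff ((a ∷ p) P.* r) i ≈ a R.* coeff r i R.+ coeff (0# ∷ p P.* r) i
  coeff-∷-* a p r i = trans (coeff-+ (map (a R.*_) r) (0# ∷ p P.* r) i) (R.+-congʳ (coeff-scale a r i))

  coeff-shift-* : ∀ p r i → coeff ((0# ∷ p) P.* r) i ≈ coeff (0# ∷ p P.* r) i
  coeff-shift-* p r i =
    trans (coeff-∷-* 0# p r i) (trans (R.+-congʳ (R.zeroˡ _)) (R.+-identityˡ _))

  shift-+ : ∀ p r i → coeff (0# ∷ p) i R.+ coeff (0# ∷ r) i ≈ coeff (0# ∷ p P.+ r) i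
  shift-+ p r zero    = R.+-identityʳ 0#
  shift-+ p r (suc i) = sym (coeff-+ p r i)

  coeff-distribʳ : ∀ p r s i → coeff ((p P.+ r) P.* s) i ≈ coeff (p P.* s) i R.+ coeff (r P.* s) i
  coeff-distribʳ []      r       s i = sym (R.+-identityˡ _)
  coeff-distribʳ (a ∷ p) []      s i = sym (R.+-identityʳ _)
  coeff-distribʳ (a ∷ p) (b ∷ r) s i = begin
    coeff (((a R.+ b) ∷ (p P.+ r)) P.* s) i
      ≈⟨ coeff-∷-* (a R.+ b) (p P.+ r) s i ⟩
    (a R.+ b) R.* coeff s i R.+ coeff (0# ∷ (p P.+ r) P.* s) i
      ≈⟨ R.+-cong (R.distribʳ _ a b) (trans (shift-cong distrib i) (sym (shift-+ (p P.* s) (r P.* s) i))) ⟩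
    (a R.* coeff s i R.+ b R.* coeff s i) R.+ (coeff (0# ∷ p P.* s) i R.+ coeff (0# ∷ r P.* s) i)
      ≈⟨ interchange _ _ _ _ ⟩
    (a R.* coeff s i R.+ coeff (0# ∷ p P.* s) i) R.+ (b R.* coeff s i R.+ coeff (0# ∷ r P.* s) i)
      ≈⟨ R.+-cong (coeff-∷-* a p s i) (coeff-∷-* b r s i) ⟨
    coeff ((a ∷ p) P.* s) i R.+ coeff ((b ∷ r) P.* s) i ∎
    where
    distrib : ((p P.+ r) P.* s) P.≈ (p P.* s P.+ r P.* s)
    distrib j = trans (coeff-distribʳ p r s j) (sym (coeff-+ (p P.* s) (r P.* s) j))

  coeff-scale-* : ∀ a p r i → coeff (map (a R.*_) p P.* r) i ≈ a R.* coeff (p P.* r) i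
  coeff-scale-* a []      r i = sym (R.zeroʳ a)
  coeff-scale-* a (b ∷ p) r i = begin
    coeff (((a R.* b) ∷ map (a R.*_) p) P.* r) i
      ≈⟨ coeff-∷-* (a R.* b) (map (a R.*_) p) r i ⟩
    a R.* b R.* coeff r i R.+ coeff (0# ∷ map (a R.*_) p P.* r) i
      ≈⟨ R.+-cong (R.*-assoc a b _) (shifted i) ⟩
    a R.* (b R.* coeff r i) R.+ a R.* coeff (0# ∷ p P.* r) i
      ≈⟨ R.distribˡ a _ _ ⟨
    a R.* (b R.* coeff r i R.+ coeff (0# ∷ p P.* r) i)
      ≈⟨ R.*-congˡ (coeff-∷-* b p r i) ⟨
    a R.* coeff ((b ∷ p) P.* r) i ∎
    where
    shifted : ∀ i → coeff (0# ∷ map (a R.*_) p P.* r) i ≈ a R.* coeff (0# ∷ p P.* r) i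
    shifted zero    = sym (R.zeroʳ a)
    shifted (suc i) = coeff-scale-* a p r i

  1*-identity : ∀ p → (P.1# P.* p) P.≈ p
  1*-identity p i = begin
    coeff (P.1# P.* p) i                   ≈⟨ coeff-∷-* 1# [] p i ⟩
    1# R.* coeff p i R.+ coeff (0# ∷ []) i ≈⟨ R.+-cong (R.*-identityˡ _) (zero-coeff i) ⟩
    coeff p i R.+ 0#                       ≈⟨ R.+-identityʳ _ ⟩
    coeff p i                              ∎
    where
    zero-coeff : ∀ i → coeff (0# ∷ []) i ≈ 0#
    zero-coeff zero    = refl
    zero-coeff (suc i) = refl

  ∣-refl : ∀ p → p P.∣ p
  ∣-refl p = P.1# , 1*-identity p

  ∣-zero : ∀ p → p P.∣ []
  ∣-zero p = [] , λ _ → refl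

  ∣-shift : ∀ {d p a} → a ≈ 0# → d P.∣ p → d P.∣ (a ∷ p)
  ∣-shift {d} {p} {a} a≈0 (w , wd≈p) = 0# ∷ w , λ
    { zero    → trans (coeff-shift-* w d zero) (sym a≈0)
    ; (suc i) → trans (coeff-shift-* w d (suc i)) (wd≈p i)
    }

  -- The relation between the three polynomials is assumed coefficientwise, so that trailing zeros
  -- and the list shape of `s` do not matter. This is the divisibility step of Euclid's algorithm.
  ∣-combine : ∀ {d p r s} a → d P.∣ p → d P.∣ r →
    (∀ i → coeff s i ≈ coeff p i R.+ a R.* coeff r i) → d P.∣ s
  ∣-combine {d} {p} {r} {s} a (w , wd≈p) (v , vd≈r) s≈ = w P.+ map (a R.*_) v , λ i → begin
    coeff ((w P.+ map (a R.*_) v) P.* d) i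
      ≈⟨ coeff-distribʳ w (map (a R.*_) v) d i ⟩
    coeff (w P.* d) i R.+ coeff (map (a R.*_) v P.* d) i
      ≈⟨ R.+-cong (wd≈p i) (trans (coeff-scale-* a v d i) (R.*-congˡ (vd≈r i))) ⟩
    coeff p i R.+ a R.* coeff r i
      ≈⟨ s≈ i ⟨
    coeff s i ∎

  length-+ : ∀ p r → length r ℕ.≤ length p → length (p P.+ r) ≡ length p
  length-+ []      []      _         = ≡.refl
  length-+ (a ∷ p) []      _         = ≡.refl
  length-+ (a ∷ p) (b ∷ r) (ℕ.s≤s l) = ≡.cong suc (length-+ p r l)

  private
    -- Prepending `0#` reads the coefficient of index i - 1, with value 0 at i = 0, so one formula
    -- also covers the constant term.
    coeff-*[X-1] : ∀ p i →
      coeff (p P.* (X P.- P.1#)) i ≈ coeff (0# ∷ p) i R.- coeff p i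
    coeff-*[X-1] []      zero    = sym (R.-‿inverseʳ 0#)
    coeff-*[X-1] []      (suc i) = sym (R.-‿inverseʳ 0#)
    coeff-*[X-1] (a ∷ p) i = trans (coeff-∷-* a p (X P.- P.1#) i) (go i)
      where
      go : ∀ i → a R.* coeff (X P.- P.1#) i R.+ coeff (0# ∷ p P.* (X P.- P.1#)) i ≈
                 coeff (0# ∷ a ∷ p) i R.- coeff (a ∷ p) i
      go zero = begin
        a R.* (0# R.+ R.- 1#) R.+ 0# ≈⟨ R.+-identityʳ _ ⟩
        a R.* (0# R.+ R.- 1#)        ≈⟨ x[y-z]≈xy-xz a 0# 1# ⟩
        a R.* 0# R.- a R.* 1#        ≈⟨ R.+-cong (R.zeroʳ a) (R.-‿cong (R.*-identityʳ a)) ⟩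
        0# R.- a                     ∎
      go (suc zero) = begin
        a R.* 1# R.+ coeff (p P.* (X P.- P.1#)) 0 ≈⟨ R.+-cong (R.*-identityʳ a) (coeff-*[X-1] p 0) ⟩
        a R.+ (0# R.- coeff p 0)                  ≈⟨ R.+-congˡ (R.+-identityˡ _) ⟩
        a R.- coeff p 0                           ∎
      go (suc (suc i)) = begin
        a R.* 0# R.+ coeff (p P.* (X P.- P.1#)) (suc i) ≈⟨ R.+-congʳ (R.zeroʳ a) ⟩
        0# R.+ coeff (p P.* (X P.- P.1#)) (suc i)       ≈⟨ R.+-identityˡ _ ⟩
        coeff (p P.* (X P.- P.1#)) (suc i)              ≈⟨ coeff-*[X-1] p (suc i) ⟩
        coeff p i R.- coeff p (suc i)                   ∎

  -- The coefficients of a product with X - 1 are differences of neighbours, so they determine those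
  -- of the other factor one after another from the constant term upwards.
  *[X-1]-cancelʳ : ∀ p r → (p P.* (X P.- P.1#)) P.≈ (r P.* (X P.- P.1#)) → p P.≈ r
  *[X-1]-cancelʳ p r eq = go
    where
    step : ∀ i → coeff (0# ∷ p) i ≈ coeff (0# ∷ r) i → coeff p i ≈ coeff r i
    step i shifted = -‿injective (+-cancelˡ _ _ _ (begin
      coeff (0# ∷ p) i R.- coeff p i  ≈⟨ coeff-*[X-1] p i ⟨
      coeff (p P.* (X P.- P.1#)) i    ≈⟨ eq i ⟩
      coeff (r P.* (X P.- P.1#)) i    ≈⟨ coeff-*[X-1] r i ⟩
      coeff (0# ∷ r) i R.- coeff r i  ≈⟨ R.+-congʳ shifted ⟨
      coeff (0# ∷ p) i R.- coeff r i  ∎))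
    go : ∀ i → coeff p i ≈ coeff r i
    go zero    = step zero refl
    go (suc i) = step (suc i) (go i)

  coeff-X*-zero : ∀ p → coeff (X P.* p) 0 ≈ 0#
  coeff-X*-zero p = coeff-shift-* P.1# p 0

  coeff-X*-suc : ∀ p i → coeff (X P.* p) (suc i) ≈ coeff p i
  coeff-X*-suc p i = begin
    coeff (X P.* p) (suc i)        ≈⟨ coeff-shift-* P.1# p (suc i) ⟩
    coeff (P.1# P.* p) i           ≈⟨ 1*-identity p i ⟩
    coeff p i                      ∎

  -- Writing the longer geometric sum as 1 + X · `geo` reduces each positive coefficient to 1 + (X^n
  -- - 1) by the induction hypothesis.
  geometric-*[X-1] : ∀ n → (replicate n 1# P.* (X P.- P.1#)) P.≈ (X P.^ₚ n P.- P.1#)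
  geometric-*[X-1] zero    zero    = sym (R.-‿inverseʳ 1#)
  geometric-*[X-1] zero    (suc i) = refl
  geometric-*[X-1] (suc n) i = begin
    coeff (replicate (suc n) 1# P.* (X P.- P.1#)) i
      ≈⟨ coeff-*[X-1] (replicate (suc n) 1#) i ⟩
    coeff (0# ∷ replicate (suc n) 1#) i R.- coeff (replicate (suc n) 1#) i
                                                            ≈⟨ telescope i ⟩
    coeff (X P.^ₚ suc n) i R.+ coeff (P.- P.1#) i           ≈⟨ coeff-+ (X P.^ₚ suc n) (P.- P.1#) i ⟨
    coeff (X P.^ₚ suc n P.- P.1#) i                         ∎
    where
    geo = replicate n 1#
    telescope : ∀ i → coeff (0# ∷ 1# ∷ geo) i R.- coeff (1# ∷ geo) i ≈
                      coeff (X P.^ₚ suc n) i R.+ coeff (P.- P.1#) i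
    telescope zero    = R.+-congʳ (sym (coeff-X*-zero (X P.^ₚ n)))
    telescope (suc i) = begin
      coeff (1# ∷ geo) i R.- coeff geo i                  ≈⟨ R.+-congʳ (head-split i) ⟩
      coeff P.1# i R.+ coeff (0# ∷ geo) i R.- coeff geo i ≈⟨ R.+-assoc _ _ _ ⟩
      coeff P.1# i R.+ (coeff (0# ∷ geo) i R.- coeff geo i) ≈⟨ R.+-congˡ (coeff-*[X-1] geo i) ⟨
      coeff P.1# i R.+ coeff (geo P.* (X P.- P.1#)) i     ≈⟨ R.+-congˡ (geometric-*[X-1] n i) ⟩
      coeff P.1# i R.+ coeff (X P.^ₚ n P.- P.1#) i
        ≈⟨ R.+-congˡ (trans (coeff-+ (X P.^ₚ n) (P.- P.1#) i)
                                                              (R.+-congˡ (coeff-neg P.1# i))) ⟩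
      coeff P.1# i R.+ (coeff (X P.^ₚ n) i R.- coeff P.1# i) ≈⟨ x∙yz≈y∙xz _ _ _ ⟩
      coeff (X P.^ₚ n) i R.+ (coeff P.1# i R.- coeff P.1# i)
        ≈⟨ R.+-cong (sym (coeff-X*-suc (X P.^ₚ n) i)) (R.-‿inverseʳ _) ⟩
      coeff (X P.^ₚ suc n) (suc i) R.+ 0#                 ∎
      where
      head-split : ∀ i → coeff (1# ∷ geo) i ≈ coeff P.1# i R.+ coeff (0# ∷ geo) i
      head-split zero    = sym (R.+-identityʳ 1#)
      head-split (suc i) = sym (R.+-identityˡ _)

-- The module structure of K over F[x] and polynomial evaluation

module Action {c ℓ c′ ℓ′} (F : CommutativeRing c ℓ) (K : CommutativeRing c′ ℓ′)
  {ι : CommutativeRing.Carrier F → CommutativeRing.Carrier K}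
  (ι-hom : Morphisms.RingMorphisms.IsRingHomomorphism
             (CommutativeRing.rawRing F) (CommutativeRing.rawRing K) ι) where

  private
    module F = CommutativeRing F
    module P = Polynomial F.rawRing
    module ι = Morphisms.RingMorphisms.IsRingHomomorphism ι-hom
  open CommutativeRing K hiding (zero)
  open RingProperties ring using (x+x≈x⇒x≈0; -0#≈0#) renaming (+-inverseʳ-unique to inverseʳ-unique)
  open CommutativeSemigroupProperties +-commutativeSemigroup using (interchange)
  open CommutativeSemigroupProperties *-commutativeSemigroup using () renaming (x∙yz≈y∙xz to x*yz≈y*xz)
  open SetoidReasoning setoid

  record IsLinear (φ : Carrier → Carrier) : Set (c ⊔ c′ ⊔ ℓ′) where
    field
      cong    : Congruent _≈_ _≈_ φ
      +-homo  : ∀ x y → φ (x + y) ≈ φ x + φ y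
      *-homo  : ∀ a x → φ (ι a * x) ≈ ι a * φ x

    0-homo : φ 0# ≈ 0#
    0-homo = x+x≈x⇒x≈0 _ (trans (sym (+-homo 0# 0#)) (cong (+-identityʳ 0#)))

  *-isLinear : ∀ x → IsLinear (x *_)
  *-isLinear x = record { cong = *-congˡ ; +-homo = distribˡ x ; *-homo = λ a → x*yz≈y*xz x (ι a) }

  module _ {φ : Carrier → Carrier} (φ-linear : IsLinear φ) where
    private module φ = IsLinear φ-linear

    -- The F[x]-module structure on K in which X acts as φ.
    act : P.Poly → Carrier → Carrier
    act p z = foldr (λ a y → ι a * z + φ y) 0# p

    -- One induction with several uses: `ψ` a scalar gives linearity of the action, `ψ` = `φ` gives
    -- `act-φ`, `ψ` another action gives `act-act`, and `ψ` a multiplication gives multiplicativity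
    -- of evaluation.
    act-commute : ∀ {ψ} → IsLinear ψ → (∀ x → φ (ψ x) ≈ ψ (φ x)) →
      ∀ p z → act p (ψ z) ≈ ψ (act p z)
    act-commute {ψ} ψ-linear comm []      z = sym (IsLinear.0-homo ψ-linear)
    act-commute {ψ} ψ-linear comm (a ∷ p) z = begin
      ι a * ψ z + φ (act p (ψ z))
        ≈⟨ +-cong (ψ.*-homo a z) (trans (sym (comm _)) (φ.cong (sym (act-commute ψ-linear comm p z)))) ⟨
      ψ (ι a * z) + ψ (φ (act p z)) ≈⟨ ψ.+-homo _ _ ⟨
      ψ (ι a * z + φ (act p z))     ∎
      where module ψ = IsLinear ψ-linear

    act-isLinear : ∀ p → IsLinear (act p)
    act-isLinear p = record
      { cong   = act-cong p
      ; +-homo = act-+ p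
      ; *-homo = λ a → act-commute (*-isLinear (ι a)) (φ.*-homo a) p
      }
      where
      act-cong : ∀ p → Congruent _≈_ _≈_ (act p)
      act-cong []      eq = refl
      act-cong (a ∷ p) eq = +-cong (*-congˡ eq) (φ.cong (act-cong p eq))

      act-+ : ∀ p x y → act p (x + y) ≈ act p x + act p y
      act-+ []      x y = sym (+-identityʳ 0#)
      act-+ (a ∷ p) x y = begin
        ι a * (x + y) + φ (act p (x + y))
          ≈⟨ +-cong (distribˡ _ x y) (trans (φ.cong (act-+ p x y)) (φ.+-homo _ _)) ⟩
        (ι a * x + ι a * y) + (φ (act p x) + φ (act p y)) ≈⟨ interchange _ _ _ _ ⟩
        act (a ∷ p) x + act (a ∷ p) y                     ∎

    act-φ : ∀ p x → φ (act p x) ≈ act p (φ x)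
    act-φ p x = sym (act-commute φ-linear (λ _ → refl) p x)

    act-act : ∀ p r x → act p (act r x) ≈ act r (act p x)
    act-act p r x = act-commute (act-isLinear r) (act-φ r) p x

    act-+ₚ : ∀ p r z → act (p P.+ r) z ≈ act p z + act r z
    act-+ₚ []      r       z = sym (+-identityˡ _)
    act-+ₚ (a ∷ p) []      z = sym (+-identityʳ _)
    act-+ₚ (a ∷ p) (b ∷ r) z = begin
      ι (a F.+ b) * z + φ (act (p P.+ r) z)
        ≈⟨ +-cong (trans (*-congʳ (ι.+-homo a b)) (distribʳ z _ _))
                  (trans (φ.cong (act-+ₚ p r z)) (φ.+-homo _ _)) ⟩
      (ι a * z + ι b * z) + (φ (act p z) + φ (act r z))
        ≈⟨ interchange _ _ _ _ ⟩
      act (a ∷ p) z + act (b ∷ r) z ∎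

    act-scale : ∀ a p z → act (map (a F.*_) p) z ≈ ι a * act p z
    act-scale a []      z = sym (zeroʳ _)
    act-scale a (b ∷ p) z = begin
      ι (a F.* b) * z + φ (act (map (a F.*_) p) z)
        ≈⟨ +-cong (trans (*-congʳ (ι.*-homo a b)) (*-assoc _ _ z))
                  (trans (φ.cong (act-scale a p z)) (φ.*-homo a _)) ⟩
      ι a * (ι b * z) + ι a * φ (act p z)
        ≈⟨ distribˡ _ _ _ ⟨
      ι a * act (b ∷ p) z ∎

    act-shift : ∀ p z → act (F.0# ∷ p) z ≈ φ (act p z)
    act-shift p z = trans (+-congʳ (trans (*-congʳ ι.0#-homo) (zeroˡ z))) (+-identityˡ _)

    act-*ₚ : ∀ p r z → act (p P.* r) z ≈ act p (act r z)
    act-*ₚ []      r z = refl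
    act-*ₚ (a ∷ p) r z = begin
      act (map (a F.*_) r P.+ (F.0# ∷ p P.* r)) z
        ≈⟨ act-+ₚ (map (a F.*_) r) (F.0# ∷ p P.* r) z ⟩
      act (map (a F.*_) r) z + act (F.0# ∷ p P.* r) z
        ≈⟨ +-cong (act-scale a r z) (act-shift (p P.* r) z) ⟩
      ι a * act r z + φ (act (p P.* r) z)              ≈⟨ +-congˡ (φ.cong (act-*ₚ p r z)) ⟩
      act (a ∷ p) (act r z)                            ∎

    act-neg : ∀ p z → act (P.- p) z ≈ - act p z
    act-neg []      z = sym -0#≈0#
    act-neg (a ∷ p) z = inverseʳ-unique _ _ (begin
      (ι a * z + φ (act p z)) + (ι (F.- a) * z + φ (act (P.- p) z)) ≈⟨ interchange _ _ _ _ ⟩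
      (ι a * z + ι (F.- a) * z) + (φ (act p z) + φ (act (P.- p) z))
        ≈⟨ +-cong (trans (sym (distribʳ z _ _)) (*-congʳ (trans (+-congˡ (ι.-‿homo a)) (-‿inverseʳ _))))
                  (trans (sym (φ.+-homo _ _)) (φ.cong (trans (+-congˡ (act-neg p z)) (-‿inverseʳ _)))) ⟩
      0# * z + φ 0#   ≈⟨ +-cong (zeroˡ z) φ.0-homo ⟩
      0# + 0#         ≈⟨ +-identityʳ 0# ⟩
      0#              ∎)

    act-C : ∀ a z → act (P.C a) z ≈ ι a * z
    act-C a z = trans (+-congˡ φ.0-homo) (+-identityʳ _)

    act-1 : ∀ z → act P.1# z ≈ z
    act-1 z = trans (act-C F.1# z) (trans (*-congʳ ι.1#-homo) (*-identityˡ z))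

    -- Equal polynomials may be lists of different lengths; the surplus entries are zero and
    -- contribute nothing because `φ` sends 0 to 0.
    act-congₚ : ∀ p r → p P.≈ r → ∀ z → act p z ≈ act r z
    act-congₚ []      []      p≈r z = refl
    act-congₚ []      (b ∷ r) p≈r z = begin
      0#                      ≈⟨ trans (+-cong (zeroˡ z) φ.0-homo) (+-identityʳ 0#) ⟨
      0# * z + φ (act [] z)
        ≈⟨ +-cong (*-congʳ (trans (sym ι.0#-homo) (ι.⟦⟧-cong (p≈r 0)))) (φ.cong (act-congₚ [] r (p≈r ∘ suc) z)) ⟩
      act (b ∷ r) z           ∎
    act-congₚ (a ∷ p) []      p≈r z = begin
      act (a ∷ p) z
        ≈⟨ +-cong (*-congʳ (trans (ι.⟦⟧-cong (p≈r 0)) ι.0#-homo)) (φ.cong (act-congₚ p [] (p≈r ∘ suc) z)) ⟩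
      0# * z + φ (act [] z)   ≈⟨ trans (+-cong (zeroˡ z) φ.0-homo) (+-identityʳ 0#) ⟩
      0#                      ∎
    act-congₚ (a ∷ p) (b ∷ r) p≈r z =
      +-cong (*-congʳ (ι.⟦⟧-cong (p≈r 0))) (φ.cong (act-congₚ p r (p≈r ∘ suc) z))

    -- On a fixed vector X acts as 1, so a polynomial acts as its value at 1. This is the source of
    -- h(1) in the theorem.
    act-fixed : ∀ p {z} → φ z ≈ z → act p z ≈ ι (P.eval p F.1#) * z
    act-fixed []      {z} _   = sym (trans (*-congʳ ι.0#-homo) (zeroˡ z))
    act-fixed (a ∷ p) {z} fix = begin
      ι a * z + φ (act p z)       ≈⟨ +-congˡ (φ.cong (act-fixed p fix)) ⟩
      ι a * z + φ (ι e * z)       ≈⟨ +-congˡ (trans (φ.*-homo e z) (*-congˡ fix)) ⟩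
      ι a * z + ι e * z           ≈⟨ distribʳ z _ _ ⟨
      (ι a + ι e) * z
        ≈⟨ *-congʳ (trans (ι.+-homo a _) (+-congˡ (ι.⟦⟧-cong (F.*-identityˡ e)))) ⟨
      ι (a F.+ F.1# F.* e) * z    ∎
      where e = P.eval p F.1#

  -- Evaluation at x is the action of F[x] on 1 in which X acts as multiplication by x.
  evalAt : P.Poly → Carrier → Carrier
  evalAt p x = foldr (λ a y → ι a + x * y) 0# p

  private
    evalAt≈act : ∀ p x → evalAt p x ≈ act (*-isLinear x) p 1#
    evalAt≈act []      x = refl
    evalAt≈act (a ∷ p) x = +-cong (sym (*-identityʳ _)) (*-congˡ (evalAt≈act p x))

  evalAt-+ : ∀ p r x → evalAt (p P.+ r) x ≈ evalAt p x + evalAt r x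
  evalAt-+ p r x = begin
    evalAt (p P.+ r) x                ≈⟨ evalAt≈act (p P.+ r) x ⟩
    act (*-isLinear x) (p P.+ r) 1#   ≈⟨ act-+ₚ (*-isLinear x) p r 1# ⟩
    _                                 ≈⟨ +-cong (evalAt≈act p x) (evalAt≈act r x) ⟨
    evalAt p x + evalAt r x           ∎

  -- The module law gives p acting on r(x). Multiplication by r(x) is linear and commutes with
  -- multiplication by x, so it can be pulled out, leaving r(x) times p acting on 1.
  evalAt-* : ∀ p r x → evalAt (p P.* r) x ≈ evalAt p x * evalAt r x
  evalAt-* p r x = begin
    evalAt (p P.* r) x                ≈⟨ evalAt≈act (p P.* r) x ⟩
    L (p P.* r) 1#                    ≈⟨ act-*ₚ (*-isLinear x) p r 1# ⟩
    L p (L r 1#)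
      ≈⟨ IsLinear.cong (act-isLinear (*-isLinear x) p) (*-identityʳ _) ⟨
    L p (L r 1# * 1#)
      ≈⟨ act-commute (*-isLinear x) (*-isLinear (L r 1#)) (x*yz≈y*xz x _) p 1# ⟩
    L r 1# * L p 1#                   ≈⟨ *-cong (evalAt≈act r x) (evalAt≈act p x) ⟨
    evalAt r x * evalAt p x           ≈⟨ *-comm _ _ ⟩
    evalAt p x * evalAt r x           ∎
    where L = act (*-isLinear x)

  evalAt-neg : ∀ p x → evalAt (P.- p) x ≈ - evalAt p x
  evalAt-neg p x = trans (evalAt≈act (P.- p) x)
    (trans (act-neg (*-isLinear x) p 1#) (-‿cong (sym (evalAt≈act p x))))

  evalAt-congₚ : ∀ p r → p P.≈ r → ∀ x → evalAt p x ≈ evalAt r x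
  evalAt-congₚ p r p≈r x = trans (evalAt≈act p x)
    (trans (act-congₚ (*-isLinear x) p r p≈r 1#) (sym (evalAt≈act r x)))

  evalAt-C : ∀ a x → evalAt (P.C a) x ≈ ι a
  evalAt-C a x = trans (+-congˡ (zeroʳ x)) (+-identityʳ _)

  evalAt-1 : ∀ x → evalAt P.1# x ≈ 1#
  evalAt-1 x = trans (evalAt-C F.1# x) ι.1#-homo

  evalAt-X : ∀ x → evalAt P.X x ≈ x
  evalAt-X x = begin
    ι F.0# + x * evalAt P.1# x   ≈⟨ +-cong ι.0#-homo (*-congˡ (evalAt-1 x)) ⟩
    0# + x * 1#                  ≈⟨ trans (+-identityˡ _) (*-identityʳ x) ⟩
    x                            ∎

  evalAt-cong : ∀ p → Congruent _≈_ _≈_ (evalAt p)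
  evalAt-cong []      _   = refl
  evalAt-cong (a ∷ p) x≈y = +-congˡ (*-cong x≈y (evalAt-cong p x≈y))

  evalAt-ι : ∀ p a → evalAt p (ι a) ≈ ι (P.eval p a)
  evalAt-ι []      a = sym ι.0#-homo
  evalAt-ι (b ∷ p) a = begin
    ι b + ι a * evalAt p (ι a)      ≈⟨ +-congˡ (*-congˡ (evalAt-ι p a)) ⟩
    ι b + ι a * ι (P.eval p a)      ≈⟨ +-congˡ (ι.*-homo a _) ⟨
    ι b + ι (a F.* P.eval p a)      ≈⟨ ι.+-homo b _ ⟨
    ι (b F.+ a F.* P.eval p a)      ∎

  evalAt-∘ : ∀ p r x → evalAt (p P.∘ₚ r) x ≈ evalAt p (evalAt r x)
  evalAt-∘ []      r x = refl
  evalAt-∘ (a ∷ p) r x = begin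
    evalAt (P.C a P.+ r P.* (p P.∘ₚ r)) x
      ≈⟨ evalAt-+ (P.C a) (r P.* (p P.∘ₚ r)) x ⟩
    evalAt (P.C a) x + evalAt (r P.* (p P.∘ₚ r)) x
      ≈⟨ +-cong (evalAt-C a x) (evalAt-* r (p P.∘ₚ r) x) ⟩
    ι a + evalAt r x * evalAt (p P.∘ₚ r) x                  ≈⟨ +-congˡ (*-congˡ (evalAt-∘ p r x)) ⟩
    evalAt (a ∷ p) (evalAt r x)                             ∎

  open Exponentiation commutativeSemiring using () renaming (_^_ to _^′_)

  evalAt-X^ : ∀ m x → evalAt (P.X P.^ₚ m) x ≈ x ^′ m
  evalAt-X^ zero    x = evalAt-1 x
  evalAt-X^ (suc m) x = trans (evalAt-* P.X (P.X P.^ₚ m) x) (*-cong (evalAt-X x) (evalAt-X^ m x))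

  open MonoidSum +-monoid using (sum)

  evalAt-sum : ∀ {n} (v : Fin n → P.Poly) x → evalAt (P.sum v) x ≈ sum (λ i → evalAt (v i) x)
  evalAt-sum {zero}  v x = refl
  evalAt-sum {suc n} v x = trans (evalAt-+ (v zero) (P.sum (v ∘ suc)) x) (+-congˡ (evalAt-sum (v ∘ suc) x))

  eval-extend : ∀ p x → Polynomial.eval rawRing (map ι p) x ≡ evalAt p x
  eval-extend p x = foldr-map (λ a y → a + x * y) ι 0# p

-- Counting roots of polynomials over a finite field

module Roots {c ℓ₁ ℓ₂ q} (K : FiniteField c ℓ₁ ℓ₂ q) where
  open FiniteField K using (commutativeRing)
  open CommutativeRing commutativeRing hiding (zero)
  open FiniteFieldProperties K
  open Polynomial rawRing using (Poly; eval)
  open SetoidReasoning setoid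
  open RingSolver commutativeSemiring using (solve; _:=_; _:+_; _:*_)

  -- Synthetic division: the entries are the Horner values at `r` of the successive tails. For every
  -- constant term a, the list is the quotient of `a ∷ p` by x - r, since a drops out of the
  -- difference of two values.
  quotient : Carrier → Poly → Poly
  quotient r []      = []
  quotient r (a ∷ p) = eval (a ∷ p) r ∷ quotient r p

  length-quotient : ∀ r p → length (quotient r p) ≡ length p
  length-quotient r []      = ≡.refl
  length-quotient r (a ∷ p) = ≡.cong suc (length-quotient r p)

  -- The identity x p(x) − r p(r) = (x − r) s(x) for s = quotient r p, with
  -- both sides moved so that no subtraction occurs.
  eval-quotient : ∀ r p x →
    x * eval p x + r * eval (quotient r p) x ≈ x * eval (quotient r p) x + r * eval p r
  eval-quotient r []      x = trans (+-cong (zeroʳ x) (zeroʳ r)) (sym (+-cong (zeroʳ x) (zeroʳ r)))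
  eval-quotient r (a ∷ p) x = begin
    x * (a + x * P) + r * (Q + x * S)
      ≈⟨ solve 6 (λ a r x P Q S →
           x :* (a :+ x :* P) :+ r :* (Q :+ x :* S) :=
           x :* a :+ x :* (x :* P :+ r :* S) :+ r :* Q) refl a r x P Q S ⟩
    x * a + x * (x * P + r * S) + r * Q
      ≈⟨ +-congʳ (+-congˡ (*-congˡ (eval-quotient r p x))) ⟩
    x * a + x * (x * S + r * eval p r) + r * Q
      ≈⟨ solve 6 (λ a r x R S Q →
           x :* a :+ x :* (x :* S :+ r :* R) :+ r :* Q :=
           x :* ((a :+ r :* R) :+ x :* S) :+ r :* Q) refl a r x (eval p r) S Q ⟩
    x * (Q + x * S) + r * Q ∎
    where
    P = eval p x
    Q = eval (a ∷ p) r
    S = eval (quotient r p) x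

  -- Each Horner value is a coefficient plus `r` times the next Horner value, so if all of them
  -- vanish the coefficients vanish too, from the top down.
  quotient-zero⇒zero : ∀ r p → All (_≈ 0#) (quotient r p) → All (_≈ 0#) p × eval p r ≈ 0#
  quotient-zero⇒zero r []      _         = [] , refl
  quotient-zero⇒zero r (a ∷ p) (Q≈0 ∷ s≈0) with quotient-zero⇒zero r p s≈0
  ... | p≈0 , P≈0 =
    trans (sym (trans (+-congˡ (trans (*-congˡ P≈0) (zeroʳ r))) (+-identityʳ a))) Q≈0 ∷ p≈0 , Q≈0

  -- The length exceeds the formal degree by one, so the bound says that there are more roots than
  -- the degree. Dividing by x - r for the first root shortens both lists by one, and the remaining
  -- roots pass to the quotient because there are no zero divisors.
  roots>degree⇒zero : ∀ p rs → Unique setoid rs → All (λ r → eval p r ≈ 0#) rs →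
    length p ℕ.≤ length rs → All (_≈ 0#) p
  roots>degree⇒zero []      rs       _            _             _          = []
  roots>degree⇒zero (a ∷ p) (r ∷ rs) (r∉rs ∷ rs!) (root ∷ roots) (ℕ.s≤s l)
    with quotient-zero⇒zero r p
           (roots>degree⇒zero (quotient r p) rs rs! (All.zipWith quotient-root (r∉rs , roots))
             (≡.subst (ℕ._≤ length rs) (≡.sym (length-quotient r p)) l))
    where
    quotient-root : ∀ {x} → (¬ (r ≈ x)) × (eval (a ∷ p) x ≈ 0#) → eval (quotient r p) x ≈ 0#
    quotient-root {x} (r≉x , root′)
      with integral (x - r) (eval (quotient r p) x) (begin
             (x - r) * S    ≈⟨ [y-z]x≈yx-zx S x r ⟩
             x * S - r * S  ≈⟨ x≈y⇒x∙y⁻¹≈ε (sym rS≈xS) ⟩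
             0#             ∎)
      where
      S = eval (quotient r p) x
      xP≈rP : x * eval p x ≈ r * eval p r
      xP≈rP = +-cancelˡ a _ _ (trans root′ (sym root))
      rS≈xS : r * S ≈ x * S
      rS≈xS = +-cancelˡ (r * eval p r) _ _ (begin
        r * eval p r + r * S  ≈⟨ +-congʳ xP≈rP ⟨
        x * eval p x + r * S  ≈⟨ eval-quotient r p x ⟩
        x * S + r * eval p r  ≈⟨ +-comm _ _ ⟩
        r * eval p r + x * S  ∎)
    ... | inj₁ x-r≈0 = contradiction (sym (x∙y⁻¹≈ε⇒x≈y x r x-r≈0)) r≉x
    ... | inj₂ S≈0   = S≈0
  ... | p≈0 , P≈0 = trans (sym (trans (+-congˡ (trans (*-congˡ P≈0) (zeroʳ r))) (+-identityʳ a))) root ∷ p≈0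

  private
    -- x ^ (2 + m) − x
    powerMinusX : ℕ → Poly
    powerMinusX m = 0# ∷ - 1# ∷ replicate m 0# ++ 1# ∷ []

    eval-monomial : ∀ m x → eval (replicate m 0# ++ 1# ∷ []) x ≈ x ^′ m
    eval-monomial zero    x = trans (+-congˡ (zeroʳ x)) (+-identityʳ 1#)
    eval-monomial (suc m) x = trans (+-identityˡ _) (*-congˡ (eval-monomial m x))

    powerMinusX-root : ∀ m {x} → x ^′ suc (suc m) ≈ x → eval (powerMinusX m) x ≈ 0#
    powerMinusX-root m {x} eq = begin
      0# + x * (- 1# + x * eval (replicate m 0# ++ 1# ∷ []) x) ≈⟨ +-identityˡ _ ⟩
      x * (- 1# + x * eval (replicate m 0# ++ 1# ∷ []) x)
        ≈⟨ *-congˡ (+-congˡ (*-congˡ (eval-monomial m x))) ⟩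
      x * (- 1# + x ^′ suc m)       ≈⟨ distribˡ x _ _ ⟩
      x * - 1# + x ^′ suc (suc m)
        ≈⟨ +-cong (trans (sym (-‿distribʳ-* x 1#)) (-‿cong (*-identityʳ x))) eq ⟩
      - x + x                       ≈⟨ -‿inverseˡ x ⟩
      0#                            ∎

    length-powerMinusX : ∀ m → length (powerMinusX m) ≡ suc (suc (suc m))
    length-powerMinusX m = ≡.cong (λ l → suc (suc l))
      (≡.trans (length-++ (replicate m 0#) {1# ∷ []})
        (≡.trans (≡.cong (ℕ._+ 1) (length-replicate m)) (ℕ.+-comm m 1)))

  -- A fixed point outside the image of `f` would give x^r - x, a list of r + 1 coefficients, r + 1
  -- distinct roots. All coefficients would then vanish, among them the -1 at x.
  fixed-points-exhausted : ∀ r → 1 < r → 1 < q → (f : Fin r → Carrier) → Injective _≡_ _≈_ f →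
    (∀ i → f i ^′ r ≈ f i) → ∀ y → y ^′ r ≈ y → ¬ (∀ i → ¬ (f i ≈ y))
  fixed-points-exhausted (suc zero)       (s<s ())
  fixed-points-exhausted r@(suc (suc m)) _ 1<q f f-inj f-fixed y y-fixed f≉y
    with roots>degree⇒zero (powerMinusX m) (y ∷ tabulate f)
           (All.tabulate⁺ (λ i eq → f≉y i (sym eq)) ∷ Unique.tabulate⁺ setoid f-inj)
           (powerMinusX-root m y-fixed ∷ All.tabulate⁺ (λ i → powerMinusX-root m (f-fixed i)))
           (ℕ.≤-reflexive (≡.trans (length-powerMinusX m) (≡.cong suc (≡.sym (length-tabulate f)))))
  ... | _ ∷ -1≈0 ∷ _ = nontrivial 1<q (-‿injective (trans -1≈0 (sym -0#≈0#)))

-- Euclid's algorithm on annihilating polynomials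

module Euclid {c ℓ₁ ℓ₂ q c′ ℓ′} (F : FiniteField c ℓ₁ ℓ₂ q) (K : CommutativeRing c′ ℓ′)
  {ι : FiniteField.Carrier F → CommutativeRing.Carrier K}
  (ι-hom : Morphisms.RingMorphisms.IsRingHomomorphism
             (FiniteField.rawRing F) (CommutativeRing.rawRing K) ι)
  {φ : CommutativeRing.Carrier K → CommutativeRing.Carrier K}
  (φ-linear : Action.IsLinear (FiniteField.commutativeRing F) K ι-hom φ)
  (φ-zero : ∀ x → CommutativeRing._≈_ K (φ x) (CommutativeRing.0# K) →
            CommutativeRing._≈_ K x (CommutativeRing.0# K)) where

  open Action (FiniteField.commutativeRing F) K ι-hom
  open CommutativeRing K using (_≈_; 0#)

  private
    module K = CommutativeRing K
    module F where
      open CommutativeRing (FiniteField.commutativeRing F) public hiding (zero)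
      open FiniteFieldProperties F public
    module ι = Morphisms.RingMorphisms.IsRingHomomorphism ι-hom
    open PolynomialProperties (FiniteField.commutativeRing F)
    open Polynomial (FiniteField.rawRing F) using (_∣_; _≈_; _*_; 1#; _+_)
    L = act φ-linear

  act-tail : ∀ {a} p z → a F.≈ F.0# → L (a ∷ p) z K.≈ 0# → L p z K.≈ 0#
  act-tail {a} p z a≈0 eq = φ-zero _ (K.trans
    (K.sym (K.trans (K.+-congʳ (K.*-congʳ (ι.⟦⟧-cong a≈0))) (act-shift φ-linear p z))) eq)

  -- Subtracting a/b times the second polynomial cancels the constant term of the first, and `s` is
  -- the difference divided by X. The length bound on `r` keeps `s` as long as `p`, so the total
  -- length drops by one.
  eliminate : ∀ a p b r z → ¬ (b F.≈ F.0#) → length r ℕ.≤ length p →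
    L (a ∷ p) z K.≈ 0# → L (b ∷ r) z K.≈ 0# →
    ∃ λ s → length s ≡ length p × (L s z K.≈ 0#) × (∀ {d} → d ∣ s → d ∣ (b ∷ r) → d ∣ (a ∷ p))
  eliminate a p b r z b≉0 l Lp≈0 Lr≈0 with F.nonzero⇒invertible b≉0
  ... | b⁻¹ , bb⁻¹≈1 = s , length-s , act-tail s z head≈0 Ls≈0 ,
      λ d∣s d∣r → ∣-combine m (∣-shift head≈0 d∣s) d∣r recombine
    where
    m = a F.* b⁻¹
    s = p + map (F.- m F.*_) r

    length-s : length s ≡ length p
    length-s = length-+ p _ (≡.subst (ℕ._≤ length p) (≡.sym (length-map _ r)) l)

    mb≈a : m F.* b F.≈ a
    mb≈a = F.trans (F.*-assoc a b⁻¹ b)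
      (F.trans (F.*-congˡ (F.trans (F.*-comm b⁻¹ b) bb⁻¹≈1)) (F.*-identityʳ a))

    head≈0 : a F.+ F.- m F.* b F.≈ F.0#
    head≈0 = F.trans (F.+-congˡ (F.trans (F.sym (F.-‿distribˡ-* m b)) (F.-‿cong mb≈a))) (F.-‿inverseʳ a)

    -- This sum computes to the vanishing constant term followed by `s`, so `act-tail` applies to it
    -- as it stands.
    Ls≈0 : L ((a ∷ p) + map (F.- m F.*_) (b ∷ r)) z K.≈ 0#
    Ls≈0 = begin
      L ((a ∷ p) + map (F.- m F.*_) (b ∷ r)) z
        ≈⟨ act-+ₚ φ-linear (a ∷ p) (map (F.- m F.*_) (b ∷ r)) z ⟩
      L (a ∷ p) z K.+ L (map (F.- m F.*_) (b ∷ r)) z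
        ≈⟨ K.+-cong Lp≈0 (act-scale φ-linear (F.- m) (b ∷ r) z) ⟩
      0# K.+ ι (F.- m) K.* L (b ∷ r) z
        ≈⟨ K.+-congˡ (K.trans (K.*-congˡ Lr≈0) (K.zeroʳ _)) ⟩
      0# K.+ 0#                                         ≈⟨ K.+-identityʳ 0# ⟩
      0#                                                ∎
      where open SetoidReasoning K.setoid

    recombine : ∀ i → coeff (a ∷ p) i F.≈
      coeff ((a ∷ p) + map (F.- m F.*_) (b ∷ r)) i F.+ m F.* coeff (b ∷ r) i
    recombine i = F.sym (begin
      coeff ((a ∷ p) + map (F.- m F.*_) (b ∷ r)) i F.+ m F.* B
        ≈⟨ F.+-congʳ (F.trans (coeff-+ (a ∷ p) (map (F.- m F.*_) (b ∷ r)) i) (F.+-congˡ (coeff-scale (F.- m) (b ∷ r) i))) ⟩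
      A F.+ F.- m F.* B F.+ m F.* B     ≈⟨ F.+-assoc _ _ _ ⟩
      A F.+ (F.- m F.* B F.+ m F.* B)   ≈⟨ F.+-congˡ (F.+-congʳ (F.-‿distribˡ-* m B)) ⟨
      A F.+ (F.- (m F.* B) F.+ m F.* B) ≈⟨ F.+-congˡ (F.-‿inverseˡ _) ⟩
      A F.+ F.0#                        ≈⟨ F.+-identityʳ A ⟩
      A                                 ∎)
      where
      open SetoidReasoning F.setoid
      A = coeff (a ∷ p) i
      B = coeff (b ∷ r) i

  -- Euclid's algorithm run from the constant terms upwards: a polynomial with
  -- zero constant term is divided by X, which preserves annihilation of z
  -- because φ has trivial kernel.
  annihilating-common-divisor : ∀ m p r z → length p ℕ.+ length r ℕ.≤ m →
    L p z K.≈ 0# → L r z K.≈ 0# → ∃ λ d → (d ∣ p) × (d ∣ r) × (L d z K.≈ 0#)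
  annihilating-common-divisor m []      r       z _ _ Lr≈0 = r , ∣-zero r , ∣-refl r , Lr≈0
  annihilating-common-divisor m (a ∷ p) []      z _ Lp≈0 _ = a ∷ p , ∣-refl (a ∷ p) , ∣-zero (a ∷ p) , Lp≈0
  annihilating-common-divisor (suc m) (a ∷ p) (b ∷ r) z (ℕ.s≤s l) Lp≈0 Lr≈0
    with a F.≟ F.0# | b F.≟ F.0# | ℕ.≤-total (length r) (length p)
  ... | yes a≈0 | _ | _ =
    let d , d∣p , d∣r , Ld≈0 = annihilating-common-divisor m p (b ∷ r) z l (act-tail p z a≈0 Lp≈0) Lr≈0
    in d , ∣-shift a≈0 d∣p , d∣r , Ld≈0
  ... | no _ | yes b≈0 | _ =
    let d , d∣p , d∣r , Ld≈0 = annihilating-common-divisor m (a ∷ p) r z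
          (≡.subst (ℕ._≤ m) (ℕ.+-suc (length p) (length r)) l) Lp≈0 (act-tail r z b≈0 Lr≈0)
    in d , d∣p , ∣-shift b≈0 d∣r , Ld≈0
  ... | no _ | no b≉0 | inj₁ r≤p =
    let s , len , Ls≈0 , lift = eliminate a p b r z b≉0 r≤p Lp≈0 Lr≈0
        d , d∣s , d∣r , Ld≈0 = annihilating-common-divisor m s (b ∷ r) z
          (≡.subst (λ k → k ℕ.+ suc (length r) ℕ.≤ m) (≡.sym len) l) Ls≈0 Lr≈0
    in d , lift d∣s d∣r , d∣r , Ld≈0
  ... | no a≉0 | no _ | inj₂ p≤r =
    let s , len , Ls≈0 , lift = eliminate b r a p z a≉0 p≤r Lr≈0 Lp≈0
        d , d∣p , d∣s , Ld≈0 = annihilating-common-divisor m (a ∷ p) s z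
          (≡.subst (λ k → suc (length p) ℕ.+ k ℕ.≤ m) (≡.sym len)
            (≡.subst (ℕ._≤ m) (ℕ.+-suc (length p) (length r)) l)) Lp≈0 Ls≈0
    in d , d∣p , lift d∣s d∣p , Ld≈0

  -- Euclid's algorithm yields a common divisor d that kills `z`; coprimality gives 1 = w · d, so 1
  -- kills `z` as well.
  coprime-annihilators⇒zero : ∀ p r z → Polynomial.Coprime (FiniteField.rawRing F) p r →
    L p z K.≈ 0# → L r z K.≈ 0# → z K.≈ 0#
  coprime-annihilators⇒zero p r z coprime Lp≈0 Lr≈0
    with annihilating-common-divisor _ p r z ℕ.≤-refl Lp≈0 Lr≈0
  ... | d , d∣p , d∣r , Ld≈0 with coprime d∣p d∣r
  ... | w , wd≈1 = begin
    z                ≈⟨ act-1 φ-linear z ⟨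
    L 1# z           ≈⟨ act-congₚ φ-linear (w * d) 1# wd≈1 z ⟨
    L (w * d) z      ≈⟨ act-*ₚ φ-linear w d z ⟩
    L w (L d z)      ≈⟨ IsLinear.cong (act-isLinear φ-linear w) Ld≈0 ⟩
    L w 0#           ≈⟨ IsLinear.0-homo (act-isLinear φ-linear w) ⟩
    0#               ∎
    where open SetoidReasoning K.setoid

-- Frobenius, trace and linearized polynomials on the extension

module FiniteExtension {c ℓ₁ ℓ₂ c′ ℓ₁′ ℓ₂′} (q n : ℕ) .{{_ : NonZero n}} (q-primePower : IsPrimePower q)
  (F : FiniteField c ℓ₁ ℓ₂ q) (K : FiniteField c′ ℓ₁′ ℓ₂′ (q ^ n))
  (ι : FiniteField.Carrier F → FiniteField.Carrier K)
  (ι-mono : Extension.IsRingMonomorphism {q = q} {n = n} F K ι) where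

  open Extension {q = q} {n = n} F K hiding (module F; module K)

  private
    module F where
      open CommutativeRing (FiniteField.commutativeRing F) public hiding (zero)
      open FiniteFieldProperties F public
    open CommutativeRing (FiniteField.commutativeRing K) hiding (zero)
    open FiniteFieldProperties K
    module ι = Morphisms.RingMorphisms.IsRingMonomorphism ι-mono
    open Action (FiniteField.commutativeRing F) (FiniteField.commutativeRing K) ι.isRingHomomorphism
    -- With the identity as embedding, `Id.evalAt` is by definition evaluation in K[x], so the laws
    -- of evaluation also cover polynomials over K.
    module Id = Action (FiniteField.commutativeRing K) (FiniteField.commutativeRing K)
      (id-isRingHomomorphism (FiniteField.rawRing K) refl)
    open MonoidSum +-monoid using (sum; sum-cong-≋)
    open SetoidReasoning setoid

  1<q : 1 < q
  1<q = primePower>1 q-primePower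

  1<qⁿ : 1 < q ^ n
  1<qⁿ = ℕ.≤-trans 1<q (ℕ.≤-trans (ℕ.≤-reflexive (≡.sym (ℕ.^-identityʳ q)))
    (ℕ.^-monoʳ-≤ q {{F.card-nonZero}} (ℕ.>-nonZero⁻¹ n)))

  φ : Carrier → Carrier
  φ x = x ^′ q

  φ-+ : ∀ x y → φ (x + y) ≈ φ x + φ y
  φ-+ = ^-primePower-+ q-primePower n ≡.refl

  ^-ι : ∀ a m → ι a ^′ m ≈ ι (a F.^′ m)
  ^-ι a zero    = sym ι.1#-homo
  ^-ι a (suc m) = trans (*-congˡ (^-ι a m)) (sym (ι.*-homo a _))

  φ-ι : ∀ a → φ (ι a) ≈ ι a
  φ-ι a = trans (^-ι a q) (ι.⟦⟧-cong (F.x^card≈x a))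

  φ-linear : IsLinear φ
  φ-linear = record
    { cong   = ^-congˡ q
    ; +-homo = φ-+
    ; *-homo = λ a x → trans (^-distrib-* (ι a) x q) (*-congʳ (φ-ι a))
    }

  L : F[x].Poly → Carrier → Carrier
  L = act φ-linear

  L-linear : ∀ u → IsLinear (L u)
  L-linear = act-isLinear φ-linear

  -- The images under `ι` are already q distinct roots of x^q - x, so no further root exists;
  -- searching F makes the preimage explicit.
  φ-fixed⇒∈F : ∀ x → φ x ≈ x → ∃ λ a → ι a ≈ x
  φ-fixed⇒∈F x φx≈x = decidable-stable (F.preimage? setoid _≟_ ι ι.⟦⟧-cong x) λ ∄a →
    Roots.fixed-points-exhausted K q 1<q 1<qⁿ (ι ∘ F.from) (λ eq → F.from-injective (ι.injective eq))
      (λ i → φ-ι (F.from i)) x φx≈x (λ i eq → ∄a (F.from i , eq))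

  -- Passes from exponents q^i to the nested form of `act`: the tail of the sum is the same sum at
  -- `φ x`, and `φ` commutes with the action.
  sum-q-powers : ∀ u x → sum (λ i → ι (lookup u i) * x ^′ (q ^ toℕ i)) ≈ L u x
  sum-q-powers []      x = refl
  sum-q-powers (a ∷ u) x = +-cong (*-congˡ (*-identityʳ x)) (begin
    sum (λ i → ι (lookup u i) * x ^′ (q ℕ.* q ^ toℕ i))
      ≈⟨ sum-cong-≋ {length u} (λ i → *-congˡ (^-assocʳ x q (q ^ toℕ i))) ⟨
    sum (λ i → ι (lookup u i) * φ x ^′ (q ^ toℕ i))     ≈⟨ sum-q-powers u (φ x) ⟩
    L u (φ x)                                           ≈⟨ act-φ φ-linear u x ⟨
    φ (L u x)                                           ∎)

  eval-linearizedAssociate : ∀ u x → evalAt (F[x].linearizedAssociate q u) x ≈ L u x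
  eval-linearizedAssociate u x = begin
    evalAt (F[x].linearizedAssociate q u) x
      ≈⟨ evalAt-sum {length u} (λ i → F[x].C (lookup u i) F[x].* F[x].X F[x].^ₚ (q ^ toℕ i)) x ⟩
    sum (λ i → evalAt (F[x].C (lookup u i) F[x].* F[x].X F[x].^ₚ (q ^ toℕ i)) x)
      ≈⟨ sum-cong-≋ {length u} (λ i → trans (evalAt-* (F[x].C (lookup u i)) (F[x].X F[x].^ₚ (q ^ toℕ i)) x)
           (*-cong (evalAt-C (lookup u i) x) (evalAt-X^ (q ^ toℕ i) x))) ⟩
    sum (λ i → ι (lookup u i) * x ^′ (q ^ toℕ i))               ≈⟨ sum-q-powers u x ⟩
    L u x                                                       ∎

  geometric : ℕ → F[x].Poly
  geometric m = replicate m F.1#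

  -- Taken as the action of 1 + X + ... + X^(n-1) rather than as a power sum, so that linearity and
  -- commuting with L_h are inherited from `act`.
  Tr : Carrier → Carrier
  Tr = L (geometric n)

  open IsLinear (L-linear (geometric n)) using () renaming (cong to Tr-cong; +-homo to Tr-+; *-homo to Tr-*)

  eval-tracePoly : ∀ x → K[x].eval (K[x].tracePoly q n) x ≈ Tr x
  eval-tracePoly x = begin
    Id.evalAt (K[x].tracePoly q n) x
      ≈⟨ Id.evalAt-sum {n} (λ i → K[x].X K[x].^ₚ (q ^ toℕ i)) x ⟩
    sum {n} (λ i → Id.evalAt (K[x].X K[x].^ₚ (q ^ toℕ i)) x)
      ≈⟨ sum-cong-≋ {n} (λ i → Id.evalAt-X^ (q ^ toℕ i) x) ⟩
    sum {n} (λ i → x ^′ (q ^ toℕ i))                          ≈⟨ go n x ⟩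
    Tr x                                                      ∎
    where
    go : ∀ m x → sum {m} (λ i → x ^′ (q ^ toℕ i)) ≈ L (geometric m) x
    go zero    x = refl
    go (suc m) x = +-cong (trans (*-comm x 1#) (*-congʳ (sym ι.1#-homo))) (begin
      sum {m} (λ i → x ^′ (q ℕ.* q ^ toℕ i))   ≈⟨ sum-cong-≋ {m} (λ i → ^-assocʳ x q (q ^ toℕ i)) ⟨
      sum {m} (λ i → φ x ^′ (q ^ toℕ i))       ≈⟨ go m (φ x) ⟩
      L (geometric m) (φ x)                    ≈⟨ act-φ φ-linear (geometric m) x ⟨
      φ (L (geometric m) x)                    ∎)

  -- Frobenius shifts the powers in the trace by one place, and x^(q^n) = x closes the cycle. Adding
  -- x on both sides keeps the telescoping free of subtraction.
  φ-Tr : ∀ x → φ (Tr x) ≈ Tr x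
  φ-Tr x = +-cancelʳ x _ _ (trans (telescope n x) (+-congˡ (x^card≈x x)))
    where
    telescope : ∀ m x → φ (L (geometric m) x) + x ≈ L (geometric m) x + x ^′ (q ^ m)
    telescope zero    x = +-cong (IsLinear.0-homo φ-linear) (sym (*-identityʳ x))
    telescope (suc m) x = begin
      φ (L (geometric (suc m)) x) + x
        ≈⟨ +-congʳ (trans (act-φ φ-linear (geometric (suc m)) x) (+-comm _ _)) ⟩
      φ (L (geometric m) (φ x)) + ι F.1# * φ x + x
        ≈⟨ +-congʳ (trans (+-congˡ ι1*) (telescope m (φ x))) ⟩
      L (geometric m) (φ x) + φ x ^′ (q ^ m) + x  ≈⟨ +-assoc _ _ x ⟩
      L (geometric m) (φ x) + (φ x ^′ (q ^ m) + x)
        ≈⟨ +-cong (sym (act-φ φ-linear (geometric m) x)) (+-comm _ x) ⟩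
      φ (L (geometric m) x) + (x + φ x ^′ (q ^ m))  ≈⟨ +-assoc _ x _ ⟨
      φ (L (geometric m) x) + x + φ x ^′ (q ^ m)
        ≈⟨ +-cong (trans (+-comm _ x) (+-congʳ (sym ι1*))) (^-assocʳ x q (q ^ m)) ⟩
      L (geometric (suc m)) x + x ^′ (q ^ suc m)  ∎
      where
      ι1* : ∀ {y} → ι F.1# * y ≈ y
      ι1* = trans (*-congʳ ι.1#-homo) (*-identityˡ _)

  -- At a point of F, the value of `f` is an F-linear combination of its coefficients, so Tr can be
  -- applied to each coefficient.
  Tr-eval : ∀ f a → Tr (K[x].eval f (ι a)) ≈ K[x].eval (K[x].T q n f) (ι a)
  Tr-eval []      a = IsLinear.0-homo (L-linear (geometric n))
  Tr-eval (y ∷ f) a = begin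
    Tr (y + ι a * K[x].eval f (ι a))      ≈⟨ Tr-+ y _ ⟩
    Tr y + Tr (ι a * K[x].eval f (ι a))
      ≈⟨ +-cong (sym (eval-tracePoly y)) (trans (Tr-* a _) (*-congˡ (Tr-eval f a))) ⟩
    K[x].eval (K[x].T q n (y ∷ f)) (ι a)  ∎

  -- The modulus x^q - x vanishes at the points of F, hence the restriction to arguments `ι a`.
  eval-cong-mod : ∀ p r a → p K[x].≡ r [mod extend ι (F[x].X F[x].^ₚ q F[x].- F[x].X) ] →
    K[x].eval p (ι a) ≈ K[x].eval r (ι a)
  eval-cong-mod p r a (w , eq) = x∙y⁻¹≈ε⇒x≈y _ _ (begin
    P + - R                               ≈⟨ +-congˡ (Id.evalAt-neg r (ι a)) ⟨
    P + K[x].eval (K[x].- r) (ι a)        ≈⟨ Id.evalAt-+ p (K[x].- r) (ι a) ⟨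
    K[x].eval (p K[x].- r) (ι a)
      ≈⟨ Id.evalAt-congₚ (w K[x].* extend ι m) (p K[x].- r) eq (ι a) ⟨
    K[x].eval (w K[x].* extend ι m) (ι a) ≈⟨ Id.evalAt-* w (extend ι m) (ι a) ⟩
    W * K[x].eval (extend ι m) (ι a)      ≈⟨ *-congˡ (trans (reflexive (eval-extend m (ι a))) m≈0) ⟩
    W * 0#                                ≈⟨ zeroʳ W ⟩
    0#                                    ∎)
    where
    m = F[x].X F[x].^ₚ q F[x].- F[x].X
    P = K[x].eval p (ι a)
    R = K[x].eval r (ι a)
    W = K[x].eval w (ι a)
    m≈0 : evalAt m (ι a) ≈ 0#
    m≈0 = begin
      evalAt m (ι a)            ≈⟨ evalAt-+ (F[x].X F[x].^ₚ q) (F[x].- F[x].X) (ι a) ⟩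
      _ ≈⟨ +-cong (evalAt-X^ q (ι a)) (trans (evalAt-neg F[x].X (ι a)) (-‿cong (evalAt-X (ι a)))) ⟩
      φ (ι a) - ι a             ≈⟨ +-congʳ (φ-ι a) ⟩
      ι a - ι a                 ≈⟨ -‿inverseʳ (ι a) ⟩
      0#                        ∎

  -- The permutation property

  module _ (b h k : F[x].Poly) (f : K[x].Poly)
    (f≡ : K[x].T q n f K[x].≡ extend ι (b F[x].- F[x].C (F[x].eval h F.1#) F[x].* k F[x].* F[x].X)
            [mod extend ι (F[x].X F[x].^ₚ q F[x].- F[x].X) ]) where

    eval-𝒫 : ∀ x → K[x].eval (𝒫 ι f h k) x ≈ K[x].eval f (Tr x) + evalAt k (Tr x) * L h x
    eval-𝒫 x = begin
      K[x].eval (𝒫 ι f h k) x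
        ≈⟨ Id.evalAt-+ (f K[x].∘ₚ t) ((extend ι k K[x].∘ₚ t) K[x].* extend ι (F[x].linearizedAssociate q h)) x ⟩
      K[x].eval (f K[x].∘ₚ t) x + K[x].eval ((extend ι k K[x].∘ₚ t) K[x].* extend ι (F[x].linearizedAssociate q h)) x
        ≈⟨ +-cong (eval-∘Tr f) (trans (Id.evalAt-* (extend ι k K[x].∘ₚ t) (extend ι (F[x].linearizedAssociate q h)) x)
             (*-cong (trans (eval-∘Tr (extend ι k)) (reflexive (eval-extend k (Tr x))))
                     (trans (reflexive (eval-extend (F[x].linearizedAssociate q h) x)) (eval-linearizedAssociate h x)))) ⟩
      K[x].eval f (Tr x) + evalAt k (Tr x) * L h x ∎
      where
      t = K[x].tracePoly q n
      eval-∘Tr : ∀ p → K[x].eval (p K[x].∘ₚ t) x ≈ K[x].eval p (Tr x)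
      eval-∘Tr p = trans (Id.evalAt-∘ p t x) (Id.evalAt-cong p (eval-tracePoly x))

    -- The preimage `a` is a parameter because b and k are evaluated in F while the trace lies in K.
    -- As k(a) is then a scalar from F, it passes through Tr.
    Tr-𝒫 : ∀ x a → ι a ≈ Tr x → Tr (K[x].eval (𝒫 ι f h k) x) ≈ ι (F[x].eval b a)
    Tr-𝒫 x a ιa≈Tr = begin
      Tr (K[x].eval (𝒫 ι f h k) x)
        ≈⟨ Tr-cong (trans (eval-𝒫 x) (+-cong (Id.evalAt-cong f (sym ιa≈Tr))
             (*-congʳ (trans (evalAt-cong k (sym ιa≈Tr)) (evalAt-ι k a))))) ⟩
      Tr (K[x].eval f (ι a) + ι k[a] * L h x)
        ≈⟨ Tr-+ _ _ ⟩
      Tr (K[x].eval f (ι a)) + Tr (ι k[a] * L h x)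
        ≈⟨ +-cong Tr-f Tr-kL ⟩
      ι b[a] - D + D
        ≈⟨ //-rightDividesˡ D (ι b[a]) ⟩
      ι b[a] ∎
      where
      k[a] = F[x].eval k a
      b[a] = F[x].eval b a
      h[1] = F[x].eval h F.1#
      D    = ι h[1] * ι k[a] * ι a
      ckX  = F[x].C h[1] F[x].* k F[x].* F[x].X

      Tr-f : Tr (K[x].eval f (ι a)) ≈ ι b[a] - D
      Tr-f = begin
        Tr (K[x].eval f (ι a))                       ≈⟨ Tr-eval f a ⟩
        K[x].eval (K[x].T q n f) (ι a)
          ≈⟨ eval-cong-mod (K[x].T q n f) (extend ι (b F[x].- ckX)) a f≡ ⟩
        K[x].eval (extend ι (b F[x].- ckX)) (ι a)    ≡⟨ eval-extend (b F[x].- ckX) (ι a) ⟩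
        evalAt (b F[x].- ckX) (ι a)                  ≈⟨ evalAt-+ b (F[x].- ckX) (ι a) ⟩
        evalAt b (ι a) + evalAt (F[x].- ckX) (ι a)
          ≈⟨ +-cong (evalAt-ι b a) (evalAt-neg ckX (ι a)) ⟩
        ι b[a] - evalAt ckX (ι a)                    ≈⟨ +-congˡ (-‿cong (begin
          evalAt ckX (ι a)
            ≈⟨ evalAt-* (F[x].C h[1] F[x].* k) F[x].X (ι a) ⟩
          evalAt (F[x].C h[1] F[x].* k) (ι a) * evalAt F[x].X (ι a)
            ≈⟨ *-cong (evalAt-* (F[x].C h[1]) k (ι a)) (evalAt-X (ι a)) ⟩
          evalAt (F[x].C h[1]) (ι a) * evalAt k (ι a) * ι a
            ≈⟨ *-congʳ (*-cong (evalAt-C h[1] (ι a)) (evalAt-ι k a)) ⟩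
          D ∎)) ⟩
        ι b[a] - D                                   ∎

      Tr-kL : Tr (ι k[a] * L h x) ≈ D
      Tr-kL = begin
        Tr (ι k[a] * L h x)          ≈⟨ Tr-* k[a] _ ⟩
        ι k[a] * Tr (L h x)          ≈⟨ *-congˡ (act-act φ-linear (geometric n) h x) ⟩
        ι k[a] * L h (Tr x)          ≈⟨ *-congˡ (act-fixed φ-linear h (φ-Tr x)) ⟩
        ι k[a] * (ι h[1] * Tr x)     ≈⟨ *-assoc _ _ _ ⟨
        ι k[a] * ι h[1] * Tr x       ≈⟨ *-cong (*-comm _ _) (sym ιa≈Tr) ⟩
        D                            ∎

    module _ (b-inj : Injective F._≈_ F._≈_ (F[x].eval b))
      (g : F[x].Poly) (g≈ : (g F[x].* (F[x].X F[x].- F[x].1#)) F[x].≈ (F[x].X F[x].^ₚ n F[x].- F[x].1#))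
      (h-coprime-g : F[x].Coprime h g) (k≉0 : ∀ a → ¬ (F[x].eval k a F.≈ F.0#)) where

      open PolynomialProperties (FiniteField.commutativeRing F) using (*[X-1]-cancelʳ; geometric-*[X-1])

      -- The quotient is known only through its product with X - 1; cancelling that factor
      -- identifies it with the polynomial whose action is Tr.
      g≈geometric : g F[x].≈ geometric n
      g≈geometric = *[X-1]-cancelʳ g (geometric n) λ i → F.trans (g≈ i) (F.sym (geometric-*[X-1] n i))

      ker-L∩ker-Tr : ∀ z → L h z ≈ 0# → Tr z ≈ 0# → z ≈ 0#
      ker-L∩ker-Tr z Lz≈0 Trz≈0 =
        Euclid.coprime-annihilators⇒zero F (FiniteField.commutativeRing K) ι.isRingHomomorphism
          φ-linear (λ x → ^-zero⇒zero x q) h g z h-coprime-g Lz≈0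
          (trans (act-congₚ φ-linear g (geometric n) g≈geometric z) Trz≈0)

      linear-difference : ∀ {ψ} → IsLinear ψ → ∀ x y → ψ x ≈ ψ y → ψ (x - y) ≈ 0#
      linear-difference {ψ} ψ-linear x y eq = +-identityˡ-unique _ (ψ y) (begin
        ψ (x - y) + ψ y   ≈⟨ +-homo _ y ⟨
        ψ (x - y + y)     ≈⟨ cong (//-rightDividesˡ y x) ⟩
        ψ x               ≈⟨ eq ⟩
        ψ y               ∎)
        where open IsLinear ψ-linear

      eval-𝒫-injective : Injective _≈_ _≈_ (K[x].eval (𝒫 ι f h k))
      eval-𝒫-injective {x} {y} eq with φ-fixed⇒∈F (Tr x) (φ-Tr x) | φ-fixed⇒∈F (Tr y) (φ-Tr y)
      ... | a , ιa≈Trx | a′ , ιa′≈Try = x∙y⁻¹≈ε⇒x≈y x y (ker-L∩ker-Tr (x - y)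
          (linear-difference (L-linear h) x y Lx≈Ly)
          (linear-difference (L-linear (geometric n)) x y Trx≈Try))
        where
        a≈a′ : a F.≈ a′
        a≈a′ = b-inj (ι.injective (begin
          ι (F[x].eval b a)              ≈⟨ Tr-𝒫 x a ιa≈Trx ⟨
          Tr (K[x].eval (𝒫 ι f h k) x)   ≈⟨ Tr-cong eq ⟩
          Tr (K[x].eval (𝒫 ι f h k) y)   ≈⟨ Tr-𝒫 y a′ ιa′≈Try ⟩
          ι (F[x].eval b a′)             ∎))

        Trx≈Try : Tr x ≈ Tr y
        Trx≈Try = trans (sym ιa≈Trx) (trans (ι.⟦⟧-cong a≈a′) ιa′≈Try)

        k≉0′ : ¬ (evalAt k (Tr x) ≈ 0#)
        k≉0′ k≈0 = k≉0 a (ι.injective (begin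
          ι (F[x].eval k a)     ≈⟨ evalAt-ι k a ⟨
          evalAt k (ι a)        ≈⟨ evalAt-cong k ιa≈Trx ⟩
          evalAt k (Tr x)       ≈⟨ k≈0 ⟩
          0#                    ≈⟨ ι.0#-homo ⟨
          ι F.0#                ∎))

        Lx≈Ly : L h x ≈ L h y
        -- Equal traces make the `f` summands and the `k` factors agree, so the former cancel and
        -- the latter, being nonzero, can be divided out.
        Lx≈Ly = *-cancelˡ-nonzero k≉0′ (+-cancelˡ (K[x].eval f (Tr x)) _ _ (begin
          K[x].eval f (Tr x) + evalAt k (Tr x) * L h x   ≈⟨ eval-𝒫 x ⟨
          K[x].eval (𝒫 ι f h k) x                        ≈⟨ eq ⟩
          K[x].eval (𝒫 ι f h k) y                        ≈⟨ eval-𝒫 y ⟩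
          K[x].eval f (Tr y) + evalAt k (Tr y) * L h y
            ≈⟨ +-cong (Id.evalAt-cong f Trx≈Try) (*-congʳ (evalAt-cong k Trx≈Try)) ⟨
          K[x].eval f (Tr x) + evalAt k (Tr x) * L h y   ∎))

      𝒫-isPermutationPolynomial : K[x].IsPermutationPolynomial (𝒫 ι f h k)
      𝒫-isPermutationPolynomial = eval-𝒫-injective ,
        injective⇒surjective (Id.evalAt-cong (𝒫 ι f h k)) eval-𝒫-injective

theorem3p5 : ∀ {c ℓ₁ ℓ₂ c′ ℓ₁′ ℓ₂′} (q n : ℕ) .{{_ : NonZero n}} → IsPrimePower q →
    (F : FiniteField c ℓ₁ ℓ₂ q) (K : FiniteField c′ ℓ₁′ ℓ₂′ (q ^ n)) →
    let open Extension {q = q} {n = n} F K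
        open F[x] in
    (ι : F.Carrier → K.Carrier) → IsRingMonomorphism ι →
    (b h k : Poly) →
    IsPermutationPolynomial b →
    (g : Poly) → g * (X - 1#) ≈ X ^ₚ n - 1# → Coprime h g →
    (∀ a → ¬ (eval k a F.≈ F.0#)) →
    (f : K[x].Poly) →
    K[x].T q n f K[x].≡
      extend ι (b - C (eval h F.1#) * k * X)
      [mod extend ι (X ^ₚ q - X) ] →
    K[x].IsPermutationPolynomial (𝒫 ι f h k)
theorem3p5 q n q-primePower F K ι ι-mono b h k (b-inj , _) g g≈ h-coprime-g k≉0 f f≡ =
  FiniteExtension.𝒫-isPermutationPolynomial q n q-primePower F K ι ι-mono
    b h k f f≡ b-inj g g≈ h-coprime-g k≉0
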